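{- For every integer $N \ge 0$ and every graph $G$ on $N$ vertices, the number of inclusion-maximal sets $S \subseteq V(G)$ such that the induced subgraph $G[S]$ has maximum degree at most $1$ is at most $10^{N/5}$. In other words, $\mathcal{M}_1(N) \le 10^{N/5} \le 1.585^{N}$.
   Context: Graphs are finite, simple and undirected. For an integer $d\ge 0$, $\mathcal{M}_d(N)$ denotes the maximum, over all graphs $G$ on $N$ vertices, of the number of inclusion-maximal sets $S\subseteq V(G)$ such that $G[S]$ has maximum degree at most $d$. -}

module Defs where

open import Data.Nat using (ℕ; zero; suc; _+_; _≤_)
open import Data.Bool using (Bool; true; false; _∧_; not)
open import Data.Fin using (Fin)
open import Data.Fin.Subset using (Subset; _∈_; _∉_; ⁅_⁆; _∪_)
open import Data.Vec using (Vec; []; _∷_; lookup)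
open import Data.List using (List; []; _∷_; allFin)
open import Data.Product using (_×_)
open import Relation.Binary.PropositionalEquality using (_≡_)
open import Relation.Nullary using (¬_)

record Graph (n : ℕ) : Set where
  field
    adj     : Fin n → Fin n → Bool
    sym     : ∀ u v → adj u v ≡ adj v u
    irrefl  : ∀ v → adj v v ≡ false
open Graph public

countB : ∀ {A : Set} → (A → Bool) → List A → ℕ
countB p []       = 0
countB p (x ∷ xs) with p x
... | true  = suc (countB p xs)
... | false = countB p xs

degIn : ∀ {n} → Graph n → Subset n → Fin n → ℕ
degIn G S v = countB (λ u → lookup S u ∧ adj G v u) (allFin _)

MaxDegAtMost : ∀ {n} → ℕ → Graph n → Subset n → Set
MaxDegAtMost d G S = ∀ v → v ∈ S → degIn G S v ≤ d

MaximalDegAtMost : ∀ {n} → ℕ → Graph n → Subset n → Set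
MaximalDegAtMost {n} d G S =
  MaxDegAtMost d G S ×
  (∀ (T : Subset n) → (∀ v → v ∈ S → v ∈ T) → MaxDegAtMost d G T → T ≡ S)

{-# OPTIONS --safe #-}
module Submission where

-- Call S dissociated if G[S] has maximum degree at most 1. If S is a maximal dissociated set of G[A] and C is a
-- union of components of G[S], then S ∖ C is a maximal dissociated set of G[A ∖ N[C]]; likewise S stays maximal
-- in G[A ∖ v] when v ∉ S. Hence, by induction on |A|, a list of such cases covering all S, each deleting k
-- vertices, proves the bound as soon as the sum of the 10^(-k/5) is at most 1. Such a list is found around a
-- vertex v of A as follows.
--  * deg v ≥ 4: split into v ∉ S, v isolated in S, and v matched in S with a neighbour u. The sum is at most 1
--    unless deg v = 4 and N[v] is a component. In that case S either contains v and one of its 4 neighbours, or it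
--    meets N(v) in one of at most 6 maximal sets of G[N(v)].
--  * deg v ≤ 2, or deg v = 3 in a cubic graph: if v is not isolated in S, then S has an edge meeting N(v) or two
--    isolated vertices in N(v). In the cubic case the number of edges inside N(v) decides between this cover, the
--    previous one and the component argument.
-- Irrational weights are avoided by bounding 10^(-k/5) by rationals W/M.

open import Defs
open import Data.Bool using (Bool; true; false; _∧_; T)
import Data.Bool as Bool
open import Data.Empty using (⊥-elim) renaming (⊥ to Falsum)
open import Data.Fin using (Fin; zero; suc)
import Data.Fin as Fin
open import Data.Fin.Properties using (any?)
open import Data.Fin.Subset using (Subset; ⊤; ⊥; ⁅_⁆; _∈_; _∉_; _⊆_; _∩_; _∪_; _-_; ∣_∣)
open import Data.Fin.Subset.Properties
open import Data.List using (List; []; _∷_; _++_; length; map; filter; foldr; allFin; deduplicate)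
open import Data.List.Properties using (length-map; length-++; length-filter; filter-notAll)
open import Data.List.Membership.Propositional using (find; lose) renaming (_∈_ to _∈ₗ_; _∉_ to _∉ₗ_)
open import Data.List.Membership.Propositional.Properties using (∈-filter⁺; ∈-filter⁻; ∈-allFin; ∈-∃++; ∈-++⁺ˡ; ∈-++⁺ʳ; ∈-++⁻; ∈-map⁺; ∈-deduplicate⁺)
open import Data.List.Relation.Binary.Sublist.Propositional using ([]; _∷_; _∷ʳ_) renaming (_⊆_ to _⊑_; ⊆-refl to ⊑-refl; ⊆-trans to ⊑-trans; lookup to ⊑-lookup)
open import Data.List.Relation.Binary.Sublist.Propositional.Properties using (All-resp-⊆)
open import Data.List.Relation.Unary.All as All using (All; []; _∷_)
import Data.List.Relation.Unary.All.Properties as All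
open import Data.List.Relation.Unary.AllPairs using ([]; _∷_)
open import Data.List.Relation.Unary.Any as Any using (Any; here; there)
open import Data.List.Relation.Unary.Unique.Propositional using (Unique)
import Data.List.Relation.Unary.Unique.Propositional.Properties as Unique
import Data.List.Relation.Unary.Unique.DecPropositional.Properties as DecUnique
open import Data.Nat using (ℕ; zero; suc; _+_; _*_; _^_; _≤_; _<_; z≤n; s≤s; NonZero; >-nonZero; >-nonZero⁻¹; _≤ᵇ_; _≤?_)
open import Data.Nat.Solver using (module +-*-Solver)
open +-*-Solver using (solve; _:=_; _:+_; _:*_; con)
open import Data.Nat.Properties as ℕ using (≤-trans; ≤-refl; ≤-reflexive; module ≤-Reasoning)
open import Data.Product using (∃; ∃₂; _×_; _,_; proj₁; proj₂)
open import Data.Sum using (_⊎_; inj₁; inj₂; [_,_]′; swap)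
open import Data.Vec using (lookup; tabulate; _∷_)
open import Data.Vec.Properties using (lookup∘tabulate; []=⇒lookup; lookup⇒[]=)
import Data.Vec.Properties as Vec
open import Function using (_∘_; id; case_of_)
open import Relation.Binary.PropositionalEquality using (_≡_; _≢_; refl; cong; cong₂; subst; trans) renaming (sym to ≡-sym)
open import Relation.Nullary using (¬_; Dec; yes; no; does; ¬?; _×-dec_; _⊎-dec_; contradiction)
open import Relation.Nullary.Decidable using (dec-true)
open import Relation.Unary using (Pred; Decidable)

-- Lists without repetition

module _ {a} {A : Set a} where

  unique-⊆⇒length≤ : {xs ys : List A} → Unique xs → (∀ {x} → x ∈ₗ xs → x ∈ₗ ys) → length xs ≤ length ys
  unique-⊆⇒length≤ [] _ = z≤n
  unique-⊆⇒length≤ {x ∷ xs} {ys} (x∉ ∷ u) sub with ∈-∃++ (sub (here refl))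
  ... | ps , qs , refl = begin
    suc (length xs)          ≤⟨ s≤s (unique-⊆⇒length≤ u sub′) ⟩
    suc (length (ps ++ qs))  ≡⟨ cong suc (length-++ ps) ⟩
    suc (length ps + length qs) ≡⟨ ℕ.+-suc (length ps) (length qs) ⟨
    length ps + suc (length qs) ≡⟨ length-++ ps ⟨
    length (ps ++ x ∷ qs)    ∎
    where
    open ≤-Reasoning
    sub′ : ∀ {y} → y ∈ₗ xs → y ∈ₗ ps ++ qs
    sub′ y∈ with ∈-++⁻ ps (sub (there y∈))
    ... | inj₁ p = ∈-++⁺ˡ p
    ... | inj₂ (there q) = ∈-++⁺ʳ ps q
    ... | inj₂ (here refl) = contradiction refl (All.lookup x∉ y∈)

  0<length⇒∃∈ : {xs : List A} → 0 < length xs → ∃ (_∈ₗ xs)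
  0<length⇒∃∈ {x ∷ _} _ = x , here refl

  length≡0 : {xs : List A} → length xs ≡ 0 → xs ≡ []
  length≡0 {[]} _ = refl

  length≡1 : (xs : List A) → length xs ≡ 1 → ∃ λ x → xs ≡ x ∷ []
  length≡1 (x ∷ []) _ = x , refl

  length≡2 : (xs : List A) → length xs ≡ 2 → ∃₂ λ x y → xs ≡ x ∷ y ∷ []
  length≡2 (x ∷ y ∷ []) _ = x , y , refl

  length≡3 : (xs : List A) → length xs ≡ 3 → ∃ λ x → ∃₂ λ y z → xs ≡ x ∷ y ∷ z ∷ []
  length≡3 (x ∷ y ∷ z ∷ []) _ = x , y , z , refl

  all-equal⇒length≤1 : {xs : List A} → Unique xs → (∀ {x y} → x ∈ₗ xs → y ∈ₗ xs → x ≡ y) → length xs ≤ 1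
  all-equal⇒length≤1 {[]} _ _ = z≤n
  all-equal⇒length≤1 {_ ∷ []} _ _ = s≤s z≤n
  all-equal⇒length≤1 {_ ∷ _ ∷ _} ((x≢y ∷ _) ∷ _) eq = contradiction (eq (here refl) (there (here refl))) x≢y

  unique-map : ∀ {b p} {B : Set b} {P : Pred A p} {f : A → B} →
               (∀ {x y} → P x → P y → f x ≡ f y → x ≡ y) →
               {xs : List A} → All P xs → Unique xs → Unique (map f xs)
  unique-map inj [] [] = []
  unique-map inj (px ∷ pxs) (x∉ ∷ u) =
    All.map⁺ (All.zipWith (λ (py , x≢y) → x≢y ∘ inj px py) (pxs , x∉)) ∷ unique-map inj pxs u

  unique-⊑ : {xs ys : List A} → xs ⊑ ys → Unique ys → Unique xs
  unique-⊑ [] [] = []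
  unique-⊑ (_ ∷ʳ s) (_ ∷ u) = unique-⊑ s u
  unique-⊑ (refl ∷ s) (x∉ ∷ u) = All-resp-⊆ s x∉ ∷ unique-⊑ s u

  -- Both parts are sublists of `xs`, so the parts of a sublist of `L` inherit all that is known
  -- about `L`.
  split-⊎ : ∀ {p q} {P : Pred A p} {Q : Pred A q} {xs : List A} → All (λ x → P x ⊎ Q x) xs →
            ∃₂ λ ys zs → ys ⊑ xs × zs ⊑ xs × All P ys × All Q zs × length ys + length zs ≡ length xs
  split-⊎ [] = [] , [] , [] , [] , [] , [] , refl
  split-⊎ {xs = x ∷ _} (inj₁ p ∷ pqs) with split-⊎ pqs
  ... | ys , zs , s , t , ps , qs , e = x ∷ ys , zs , refl ∷ s , x ∷ʳ t , p ∷ ps , qs , cong suc e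
  split-⊎ {xs = x ∷ _} (inj₂ q ∷ pqs) with split-⊎ pqs
  ... | ys , zs , s , t , ps , qs , e =
    ys , x ∷ zs , x ∷ʳ s , refl ∷ t , ps , q ∷ qs , trans (ℕ.+-suc (length ys) _) (cong suc e)


countB≡length-filter : {A : Set} (p : A → Bool) (xs : List A) → countB p xs ≡ length (filter (λ x → p x Bool.≟ true) xs)
countB≡length-filter p [] = refl
countB≡length-filter p (x ∷ xs) with p x
... | true  = cong suc (countB≡length-filter p xs)
... | false = countB≡length-filter p xs

-- Subsets of `Fin n` and their sizes

module _ {n : ℕ} where

  _≢?_ : (x y : Fin n) → Dec (x ≢ y)
  x ≢? y = ¬? (x Fin.≟ y)

  ⟦_⟧ : ∀ {p} {P : Pred (Fin n) p} → Decidable P → Subset n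
  ⟦ P? ⟧ = tabulate (does ∘ P?)

  module _ {p} {P : Pred (Fin n) p} (P? : Decidable P) where

    ∈⟦⟧⁺ : ∀ {x} → P x → x ∈ ⟦ P? ⟧
    ∈⟦⟧⁺ {x} px = lookup⇒[]= x _ (trans (lookup∘tabulate _ x) (dec-true (P? x) px))

    ∈⟦⟧⁻ : ∀ {x} → x ∈ ⟦ P? ⟧ → P x
    ∈⟦⟧⁻ {x} x∈ with P? x | trans (≡-sym (lookup∘tabulate (does ∘ P?) x)) ([]=⇒lookup x∈)
    ... | yes px | _ = px

∣p∪⁅x⁆∣≤1+∣p∣ : ∀ {n} (p : Subset n) x → ∣ p ∪ ⁅ x ⁆ ∣ ≤ suc ∣ p ∣
∣p∪⁅x⁆∣≤1+∣p∣ (true ∷ p) zero rewrite ∪-identityʳ p = ℕ.n≤1+n _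
∣p∪⁅x⁆∣≤1+∣p∣ (false ∷ p) zero rewrite ∪-identityʳ p = ≤-refl
∣p∪⁅x⁆∣≤1+∣p∣ (true ∷ p) (suc x) = s≤s (∣p∪⁅x⁆∣≤1+∣p∣ p x)
∣p∪⁅x⁆∣≤1+∣p∣ (false ∷ p) (suc x) = ∣p∪⁅x⁆∣≤1+∣p∣ p x

∣p∣≤length : ∀ {n} (xs : List (Fin n)) {p : Subset n} → (∀ {x} → x ∈ p → x ∈ₗ xs) → ∣ p ∣ ≤ length xs
∣p∣≤length {n} xs sub = ≤-trans (p⊆q⇒∣p∣≤∣q∣ (λ x∈p → ∈-set (sub x∈p))) (∣set∣≤ xs)
  where
  set : List (Fin n) → Subset n
  set = foldr (λ x p → p ∪ ⁅ x ⁆) ⊥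
  ∈-set : ∀ {x ys} → x ∈ₗ ys → x ∈ set ys
  ∈-set {x} (here refl) = x∈p∪q⁺ (inj₂ (x∈⁅x⁆ x))
  ∈-set (there x∈) = x∈p∪q⁺ (inj₁ (∈-set x∈))
  ∣set∣≤ : ∀ ys → ∣ set ys ∣ ≤ length ys
  ∣set∣≤ [] = ≤-reflexive (∣⊥∣≡0 n)
  ∣set∣≤ (y ∷ ys) = ≤-trans (∣p∪⁅x⁆∣≤1+∣p∣ (set ys) y) (s≤s (∣set∣≤ ys))

-- Serves to count deleted vertices from below: the entries of `xs` are struck off `q` one at a
-- time, and `p` survives each time.
∣p∣+length≤∣q∣ : ∀ {n} {p q : Subset n} (xs : List (Fin n)) → p ⊆ q → Unique xs →
                All (λ x → x ∈ q × x ∉ p) xs → ∣ p ∣ + length xs ≤ ∣ q ∣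
∣p∣+length≤∣q∣ [] p⊆q _ _ = ≤-trans (≤-reflexive (ℕ.+-identityʳ _)) (p⊆q⇒∣p∣≤∣q∣ p⊆q)
∣p∣+length≤∣q∣ {p = p} {q} (x ∷ xs) p⊆q (x∉ ∷ u) ((x∈q , x∉p) ∷ all) = begin
  ∣ p ∣ + suc (length xs)   ≡⟨ ℕ.+-suc ∣ p ∣ _ ⟩
  suc (∣ p ∣ + length xs)   ≤⟨ s≤s (∣p∣+length≤∣q∣ xs p⊆q-x u (All.zipWith (λ { (x≢y , y∈q , y∉p) → x∈p∧x≢y⇒x∈p-y y∈q (x≢y ∘ ≡-sym) , y∉p }) (x∉ , all))) ⟩
  suc ∣ q - x ∣             ≤⟨ x∈p⇒∣p-x∣<∣p∣ x∈q ⟩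
  ∣ q ∣                     ∎
  where
  open ≤-Reasoning
  p⊆q-x : p ⊆ q - x
  p⊆q-x y∈p = x∈p∧x≢y⇒x∈p-y (p⊆q y∈p) λ { refl → x∉p y∈p }

-- Maximal dissociated sets

module Dissociation {N : ℕ} (G : Graph N) where

  _~_ : Fin N → Fin N → Set
  x ~ y = adj G x y ≡ true

  _~?_ : ∀ x y → Dec (x ~ y)
  x ~? y = adj G x y Bool.≟ true

  ~-sym : ∀ {x y} → x ~ y → y ~ x
  ~-sym {x} {y} = trans (Graph.sym G y x)

  ~-irrefl : ∀ {x} → ¬ (x ~ x)
  ~-irrefl {x} x~x with trans (≡-sym x~x) (irrefl G x)
  ... | ()

  ~⇒≢ : ∀ {x y} → x ~ y → x ≢ y
  ~⇒≢ x~y refl = ~-irrefl x~y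

  -- Said without counting, so that later steps only compare individual vertices.
  Dissociated : Subset N → Set
  Dissociated S = ∀ {v x y} → v ∈ S → x ∈ S → y ∈ S → v ~ x → v ~ y → x ≡ y

  private
    S-nbrs : (S : Subset N) (v : Fin N) → List (Fin N)
    S-nbrs S v = filter (λ u → (lookup S u ∧ adj G v u) Bool.≟ true) (allFin N)

    ∈-S-nbrs⁺ : ∀ {S v x} → x ∈ S → v ~ x → x ∈ₗ S-nbrs S v
    ∈-S-nbrs⁺ {x = x} x∈S v~x = ∈-filter⁺ _ (∈-allFin x) (cong₂ _∧_ ([]=⇒lookup x∈S) v~x)

    ∈-S-nbrs⁻ : ∀ {S v x} → x ∈ₗ S-nbrs S v → x ∈ S × v ~ x
    ∈-S-nbrs⁻ {S} {v} {x} x∈ with lookup S x in eq | proj₂ (∈-filter⁻ (λ u → (lookup S u ∧ adj G v u) Bool.≟ true) {xs = allFin N} x∈)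
    ... | true | e = lookup⇒[]= x S eq , e

  maxDeg⇒dissociated : ∀ {S} → MaxDegAtMost 1 G S → Dissociated S
  maxDeg⇒dissociated {S} deg {v} {x} {y} v∈ x∈ y∈ v~x v~y with x Fin.≟ y
  ... | yes x≡y = x≡y
  ... | no x≢y = contradiction two≤one λ { (s≤s ()) }
    where
    both : ∀ {z} → z ∈ₗ x ∷ y ∷ [] → z ∈ₗ S-nbrs S v
    both (here refl) = ∈-S-nbrs⁺ x∈ v~x
    both (there (here refl)) = ∈-S-nbrs⁺ y∈ v~y
    two≤one : 2 ≤ 1
    two≤one = ≤-trans (unique-⊆⇒length≤ ((x≢y ∷ []) ∷ [] ∷ []) both)
      (subst (_≤ 1) (countB≡length-filter (λ u → lookup S u ∧ adj G v u) (allFin N)) (deg v v∈))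

  dissociated⇒maxDeg : ∀ {S} → Dissociated S → MaxDegAtMost 1 G S
  dissociated⇒maxDeg {S} diss v v∈ =
    subst (_≤ 1) (≡-sym (countB≡length-filter (λ u → lookup S u ∧ adj G v u) (allFin N)))
      (all-equal⇒length≤1 {xs = S-nbrs S v} (Unique.filter⁺ _ (Unique.allFin⁺ N)) λ x∈ y∈ →
        let (x∈S , v~x) = ∈-S-nbrs⁻ x∈ ; (y∈S , v~y) = ∈-S-nbrs⁻ y∈ in diss v∈ x∈S y∈S v~x v~y)

  -- Relative to an ambient set, so that the induction runs over vertex subsets of one fixed graph
  -- and needs no induced subgraphs.
  record Maximal (A S : Subset N) : Set where
    field
      ⊆-ambient   : S ⊆ A
      dissociated : Dissociated S
      maximal     : ∀ {T} → S ⊆ T → T ⊆ A → Dissociated T → T ⊆ S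
  open Maximal public

  maximalDeg⇒maximal : ∀ {S} → MaximalDegAtMost 1 G S → Maximal ⊤ S
  maximalDeg⇒maximal {S} (deg , max) = record
    { ⊆-ambient = λ _ → ∈⊤
    ; dissociated = maxDeg⇒dissociated deg
    ; maximal = λ {T} S⊆T _ diss → subst (T ⊆_) (max T (λ _ → S⊆T) (dissociated⇒maxDeg diss)) id
    }

  -- If `T` extends `S ∩ A′` inside `A′`, then the rest of `S` can be added to `T`, as it has no
  -- edges into `A′`. The union is dissociated and contains `S`, so maximality in `A` puts it inside
  -- `S`.
  maximal-∩ : ∀ {A A′ S} → A′ ⊆ A → (∀ {x y} → x ∈ S → x ∉ A′ → y ∈ A′ → ¬ (x ~ y)) →
              Maximal A S → Maximal A′ (S ∩ A′)
  maximal-∩ {A} {A′} {S} A′⊆A sep m = record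
    { ⊆-ambient = p∩q⊆q S A′
    ; dissociated = λ v∈ x∈ y∈ → dissociated m (p∩q⊆p S A′ v∈) (p∩q⊆p S A′ x∈) (p∩q⊆p S A′ y∈)
    ; maximal = max
    }
    where
    max : ∀ {T} → S ∩ A′ ⊆ T → T ⊆ A′ → Dissociated T → T ⊆ S ∩ A′
    max {T} S∩A′⊆T T⊆A′ diss x∈T = x∈p∩q⁺ (maximal m S⊆T⁺ T⁺⊆A diss⁺ (∈⟦⟧⁺ T⁺? (inj₁ x∈T)) , T⊆A′ x∈T)
      where
      T⁺? = λ x → (x ∈? T) ⊎-dec (x ∈? S ×-dec ¬? (x ∈? A′))
      S⊆T⁺ : S ⊆ ⟦ T⁺? ⟧
      S⊆T⁺ {x} x∈S with x ∈? A′
      ... | yes x∈A′ = ∈⟦⟧⁺ T⁺? (inj₁ (S∩A′⊆T (x∈p∩q⁺ (x∈S , x∈A′))))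
      ... | no x∉A′ = ∈⟦⟧⁺ T⁺? (inj₂ (x∈S , x∉A′))
      T⁺⊆A : ⟦ T⁺? ⟧ ⊆ A
      T⁺⊆A x∈ with ∈⟦⟧⁻ T⁺? x∈
      ... | inj₁ x∈T = A′⊆A (T⊆A′ x∈T)
      ... | inj₂ (x∈S , _) = ⊆-ambient m x∈S
      diss⁺ : Dissociated ⟦ T⁺? ⟧
      diss⁺ v∈ x∈ y∈ v~x v~y with ∈⟦⟧⁻ T⁺? v∈ | ∈⟦⟧⁻ T⁺? x∈ | ∈⟦⟧⁻ T⁺? y∈
      ... | inj₁ v∈T | inj₁ x∈T | inj₁ y∈T = diss v∈T x∈T y∈T v~x v~y
      ... | inj₁ v∈T | inj₂ (x∈S , x∉) | _ = contradiction (~-sym v~x) (sep x∈S x∉ (T⊆A′ v∈T))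
      ... | inj₁ v∈T | inj₁ _ | inj₂ (y∈S , y∉) = contradiction (~-sym v~y) (sep y∈S y∉ (T⊆A′ v∈T))
      ... | inj₂ (v∈S , v∉) | inj₁ x∈T | _ = contradiction v~x (sep v∈S v∉ (T⊆A′ x∈T))
      ... | inj₂ (v∈S , v∉) | inj₂ _ | inj₁ y∈T = contradiction v~y (sep v∈S v∉ (T⊆A′ y∈T))
      ... | inj₂ (v∈S , _) | inj₂ (x∈S , _) | inj₂ (y∈S , _) = dissociated m v∈S x∈S y∈S v~x v~y

  Blocked : Subset N → Fin N → Set
  Blocked S w = (∃₂ λ x y → x ∈ S × y ∈ S × x ≢ y × w ~ x × w ~ y) ⊎ (∃₂ λ x y → x ∈ S × y ∈ S × w ~ x × x ~ y)

  -- Otherwise `w` has at most one neighbour in `S`, and that neighbour is isolated in `S`; then `w`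
  -- could be added.
  maximal⇒blocked : ∀ {A S w} → Maximal A S → w ∈ A → w ∉ S → Blocked S w
  maximal⇒blocked {A} {S} {w} m w∈A w∉S
    with any? (λ x → any? λ y → x ∈? S ×-dec y ∈? S ×-dec ¬? (x Fin.≟ y) ×-dec w ~? x ×-dec w ~? y)
       | any? (λ x → any? λ y → x ∈? S ×-dec y ∈? S ×-dec w ~? x ×-dec x ~? y)
  ... | yes b | _ = inj₁ b
  ... | no _ | yes b = inj₂ b
  ... | no ¬two | no ¬edge = contradiction (maximal m (λ x∈ → ∈⟦⟧⁺ S⁺? (inj₁ x∈)) S⁺⊆A diss⁺ (∈⟦⟧⁺ S⁺? (inj₂ refl))) w∉S
    where
    S⁺? = λ x → (x ∈? S) ⊎-dec (x Fin.≟ w)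
    S⁺⊆A : ⟦ S⁺? ⟧ ⊆ A
    S⁺⊆A x∈ with ∈⟦⟧⁻ S⁺? x∈
    ... | inj₁ x∈S = ⊆-ambient m x∈S
    ... | inj₂ refl = w∈A
    diss⁺ : Dissociated ⟦ S⁺? ⟧
    diss⁺ {v} {x} {y} v∈ x∈ y∈ v~x v~y with ∈⟦⟧⁻ S⁺? v∈ | ∈⟦⟧⁻ S⁺? x∈ | ∈⟦⟧⁻ S⁺? y∈
    ... | inj₁ v∈S | inj₁ x∈S | inj₁ y∈S = dissociated m v∈S x∈S y∈S v~x v~y
    ... | inj₁ v∈S | inj₁ x∈S | inj₂ refl = contradiction (v , x , v∈S , x∈S , ~-sym v~y , v~x) ¬edge
    ... | inj₁ v∈S | inj₂ refl | inj₁ y∈S = contradiction (v , y , v∈S , y∈S , ~-sym v~x , v~y) ¬edge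
    ... | inj₁ _ | inj₂ refl | inj₂ refl = refl
    ... | inj₂ refl | inj₂ refl | _ = contradiction v~x ~-irrefl
    ... | inj₂ refl | inj₁ _ | inj₂ refl = contradiction v~y ~-irrefl
    ... | inj₂ refl | inj₁ x∈S | inj₁ y∈S with x Fin.≟ y
    ...   | yes x≡y = x≡y
    ...   | no x≢y = contradiction (x , y , x∈S , y∈S , x≢y , v~x , v~y) ¬two

  Single : Fin N → Subset N → Set
  Single v S = v ∈ S × (∀ {y} → y ∈ S → ¬ (v ~ y))

  Pair : Fin N → Fin N → Subset N → Set
  Pair u x S = u ∈ S × x ∈ S × u ~ x

  Pair-sym : ∀ {u x S} → Pair u x S → Pair x u S
  Pair-sym (u∈ , x∈ , u~x) = x∈ , u∈ , ~-sym u~x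

  Far : Fin N → Fin N → Set
  Far v y = y ≢ v × ¬ (v ~ y)

  far? : ∀ v → Decidable (Far v)
  far? v y = ¬? (y Fin.≟ v) ×-dec ¬? (v ~? y)

  -- C is a union of components of G[S].
  Closed : List (Fin N) → Subset N → Set
  Closed C S = (∀ {c} → c ∈ₗ C → c ∈ S) × (∀ {c y} → c ∈ₗ C → y ∈ S → c ~ y → y ∈ₗ C)

  single-closed : ∀ {v S} → Single v S → Closed (v ∷ []) S
  single-closed (v∈ , alone) = (λ { (here refl) → v∈ }) , λ { (here refl) y∈ v~y → contradiction v~y (alone y∈) }

  pair-closed : ∀ {u x S} → Dissociated S → Pair u x S → Closed (u ∷ x ∷ []) S
  pair-closed diss (u∈ , x∈ , u~x) =
    (λ { (here refl) → u∈ ; (there (here refl)) → x∈ }) ,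
    λ { (here refl) y∈ u~y → there (here (diss u∈ y∈ x∈ u~y u~x))
      ; (there (here refl)) y∈ x~y → here (diss x∈ y∈ u∈ x~y (~-sym u~x)) }

  ++-closed : ∀ {C D S} → Closed C S → Closed D S → Closed (C ++ D) S
  ++-closed {C} {D} (C⊆ , Cc) (D⊆ , Dc) =
    (λ c∈ → [ C⊆ , D⊆ ]′ (∈-++⁻ C c∈)) ,
    λ c∈ y∈ c~y → [ (λ p → ∈-++⁺ˡ (Cc p y∈ c~y)) , (λ p → ∈-++⁺ʳ C (Dc p y∈ c~y)) ]′ (∈-++⁻ C c∈)

  status : ∀ {v S} → v ∈ S → Single v S ⊎ ∃ λ u → Pair v u S
  status {v} {S} v∈ with any? (λ u → u ∈? S ×-dec v ~? u)
  ... | yes (u , u∈ , v~u) = inj₂ (u , v∈ , u∈ , v~u)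
  ... | no none = inj₁ (v∈ , λ y∈ v~y → none (_ , y∈ , v~y))

  -- If one of two blocking neighbours of `v` is matched in `S`, its edge already meets N(v); only
  -- two isolated ones make a new case.
  blocked⇒near : ∀ {S v} → Blocked S v →
                 (∃₂ λ x y → v ~ x × Pair x y S) ⊎ (∃₂ λ x y → x ≢ y × v ~ x × v ~ y × Single x S × Single y S)
  blocked⇒near (inj₂ (x , y , x∈ , y∈ , v~x , x~y)) = inj₁ (x , y , v~x , x∈ , y∈ , x~y)
  blocked⇒near (inj₁ (x , y , x∈ , y∈ , x≢y , v~x , v~y)) with status x∈ | status y∈
  ... | inj₂ (z , p) | _ = inj₁ (x , z , v~x , p)
  ... | inj₁ _ | inj₂ (z , p) = inj₁ (y , z , v~y , p)
  ... | inj₁ s | inj₁ t = inj₂ (x , y , x≢y , v~x , v~y , s , t)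

  -- `u` is not in `S`, hence blocked. An isolated `v` does not block it alone, so another vertex of
  -- `S` is adjacent to `u`, and as a member of `S` it is not adjacent to `v`.
  single⇒far : ∀ {A S v u} → Maximal A S → Single v S → u ∈ A → v ~ u → ∃ λ x → x ∈ S × u ~ x × Far v x
  single⇒far {v = v} {u} m (v∈ , alone) u∈A v~u with maximal⇒blocked m u∈A (λ u∈S → alone u∈S v~u)
  ... | inj₂ (x , y , x∈ , y∈ , u~x , x~y) = x , x∈ , u~x , (λ { refl → alone y∈ x~y }) , alone x∈
  ... | inj₁ (x , y , x∈ , y∈ , x≢y , u~x , u~y) with x Fin.≟ v
  ...   | no x≢v = x , x∈ , u~x , x≢v , alone x∈
  ...   | yes refl = y , y∈ , u~y , x≢y ∘ ≡-sym , alone y∈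

-- Weights

^-distribʳ-* : ∀ k m n → (m * n) ^ k ≡ m ^ k * n ^ k
^-distribʳ-* zero m n = refl
^-distribʳ-* (suc k) m n = trans (cong (m * n *_) (^-distribʳ-* k m n))
  (solve 4 (λ m n a b → m :* n :* (a :* b) := m :* a :* (n :* b)) refl m n (m ^ k) (n ^ k))

-- W/M is an upper bound for 10^(-k/5).
record Weight (M k W : ℕ) : Set where
  constructor weight
  field
    positive : 0 < W
    bound    : M ^ 5 ≤ W ^ 5 * 10 ^ k
open Weight

-- For closed numerals the implicit argument is settled by evaluation.
≤! : ∀ {m n} {_ : T (m ≤ᵇ n)} → m ≤ n
≤! {m} {n} {t} = ℕ.≤ᵇ⇒≤ m n t

weight-mono : ∀ {M k k′ W} → k ≤ k′ → Weight M k W → Weight M k′ W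
weight-mono {W = W} k≤k′ (weight pos b) = weight pos (≤-trans b (ℕ.*-monoʳ-≤ (W ^ 5) (ℕ.^-monoʳ-≤ 10 k≤k′)))

-- 1000 · 10^(-k/5), rounded up.
cw : ℕ → ℕ
cw 0 = 1000
cw 1 = 631
cw 2 = 399
cw 3 = 252
cw 4 = 159
cw 5 = 100
cw 6 = 64
cw _ = 40

cw-weight : ∀ k → Weight 1000 k (cw k)
cw-weight 0 = weight ≤! ≤!
cw-weight 1 = weight ≤! ≤!
cw-weight 2 = weight ≤! ≤!
cw-weight 3 = weight ≤! ≤!
cw-weight 4 = weight ≤! ≤!
cw-weight 5 = weight ≤! ≤!
cw-weight 6 = weight ≤! ≤!
-- The value 40 belongs to `k = 7` and stays an upper bound for every larger `k`.
cw-weight (suc (suc (suc (suc (suc (suc (suc k))))))) = weight-mono {k = 7} (ℕ.m≤m+n 7 k) (weight ≤! ≤!)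

weight-scale : ∀ {M k W} d .{{_ : NonZero d}} → Weight M k W → Weight (M * d) k (W * d)
weight-scale {M} {k} {W} d (weight pos b) = weight (ℕ.*-mono-≤ pos (>-nonZero⁻¹ d)) (begin
  (M * d) ^ 5             ≡⟨ ^-distribʳ-* 5 M d ⟩
  M ^ 5 * d ^ 5           ≤⟨ ℕ.*-monoˡ-≤ (d ^ 5) b ⟩
  W ^ 5 * 10 ^ k * d ^ 5  ≡⟨ solve 3 (λ x y z → x :* y :* z := x :* z :* y) refl (W ^ 5) (10 ^ k) (d ^ 5) ⟩
  W ^ 5 * d ^ 5 * 10 ^ k  ≡⟨ cong (_* 10 ^ k) (^-distribʳ-* 5 W d) ⟨
  (W * d) ^ 5 * 10 ^ k    ∎)
  where open ≤-Reasoning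

-- The factor (3 + d)/(2 + d) is at most 3/2, whose fifth power 243/32 is below the factor 10 gained
-- from one more deleted vertex.
weight-suc : ∀ {M k W} d → Weight (M * (2 + d)) k W → Weight (M * (3 + d)) (suc k) W
weight-suc {M} {k} {W} d (weight pos b) = weight pos (ℕ.*-cancelˡ-≤ 32 (begin
  32 * (M * (3 + d)) ^ 5          ≡⟨ ^-distribʳ-* 5 2 (M * (3 + d)) ⟨
  (2 * (M * (3 + d))) ^ 5         ≤⟨ ℕ.^-monoˡ-≤ 5 2[3+d]≤3[2+d] ⟩
  (3 * (M * (2 + d))) ^ 5         ≡⟨ ^-distribʳ-* 5 3 (M * (2 + d)) ⟩
  243 * (M * (2 + d)) ^ 5         ≤⟨ ℕ.*-mono-≤ {243} {320} ≤! b ⟩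
  320 * (W ^ 5 * 10 ^ k)          ≡⟨ solve 2 (λ x y → con 320 :* (x :* y) := con 32 :* (x :* (con 10 :* y))) refl (W ^ 5) (10 ^ k) ⟩
  32 * (W ^ 5 * 10 ^ suc k)       ∎))
  where
  open ≤-Reasoning
  2[3+d]≤3[2+d] : 2 * (M * (3 + d)) ≤ 3 * (M * (2 + d))
  2[3+d]≤3[2+d] = ≤-trans (ℕ.m≤m+n _ (M * d))
    (≤-reflexive (solve 2 (λ m d → con 2 :* (m :* (con 3 :+ d)) :+ m :* d := con 3 :* (m :* (con 2 :+ d))) refl M d))

-- Lets `W` stay fixed while the degree grows without bound: one numerical check at the smallest
-- degree covers all larger ones.
weight-grow : ∀ {M k W} d j → Weight (M * (2 + d)) k W → Weight (M * (2 + (d + j))) (k + j) W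
weight-grow {M} {k} d zero w rewrite ℕ.+-identityʳ d | ℕ.+-identityʳ k = w
weight-grow {M} {k} d (suc j) w rewrite ℕ.+-suc d j | ℕ.+-suc k j = weight-suc {M} (d + j) (weight-grow {M} d j w)

^5-cancel-< : ∀ {m n} → m ^ 5 < n ^ 5 → m < n
^5-cancel-< m^5<n^5 = ℕ.≰⇒> λ n≤m → ℕ.<⇒≱ m^5<n^5 (ℕ.^-monoˡ-≤ 5 n≤m)

-- Fractions of a counterexample `L`

module Branching {N : ℕ} (G : Graph N) (A : Subset N)
  (ih : ∀ {A′} → ∣ A′ ∣ < ∣ A ∣ → ∀ {L} → Unique L → All (Dissociation.Maximal G A′) L → length L ^ 5 ≤ 10 ^ ∣ A′ ∣)
  {L : List (Subset N)} (L! : Unique L) (L-maximal : All (Dissociation.Maximal G A) L)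
  (large : 10 ^ ∣ A ∣ < length L ^ 5) where

  open Dissociation G

  X : ℕ
  X = length L

  X>0 : 0 < X
  X>0 = ^5-cancel-< {0} (≤-trans (s≤s z≤n) large)

  ∈L⇒maximal : ∀ {S} → S ∈ₗ L → Maximal A S
  ∈L⇒maximal = All.lookup L-maximal

  -- Sublists of L with property P make up less than a fraction W/M of L (the empty one is excluded because W may be 0).
  record Fraction (M W : ℕ) (P : Subset N → Set) : Set where
    constructor fraction
    field
      count : ∀ {K} → K ⊑ L → All P K → 0 < length K → M * length K < W * X
  open Fraction

  -- Taking all of `L` gives `M * X < W * X`. As this is strict, a total weight of exactly `M` is
  -- still contradictory.
  conclude : ∀ {M W P} → Fraction M W P → W ≤ M → (∀ {S} → Maximal A S → P S) → Falsum
  conclude {M} {W} f W≤M P-all = ℕ.<-irrefl refl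
    (ℕ.<-≤-trans (count f ⊑-refl (All.map P-all L-maximal) X>0) (ℕ.*-monoˡ-≤ X W≤M))

  weaken : ∀ {M W P Q} → (∀ {S} → S ∈ₗ L → Q S → P S) → Fraction M W P → Fraction M W Q
  weaken imp f = fraction λ K⊑L qs → count f K⊑L
    (All.tabulate λ S∈K → imp (⊑-lookup K⊑L S∈K) (All.lookup qs S∈K))

  none : ∀ {M P} → (∀ {S} → Maximal A S → ¬ P S) → Fraction M 0 P
  count (none ¬P) {S ∷ _} K⊑L (p ∷ _) _ = contradiction p (¬P (∈L⇒maximal (⊑-lookup K⊑L (here refl))))

  _∪ᶠ_ : ∀ {M W W′ P Q} → Fraction M W P → Fraction M W′ Q → Fraction M (W + W′) (λ S → P S ⊎ Q S)
  count (_∪ᶠ_ {M} {W} {W′} f g) {K} K⊑L pqs pos with split-⊎ pqs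
  -- An empty part provides no inequality, so the first two cases rest on the other part alone.
  ... | [] , zs , _ , t , _ , qs , e =
    subst (λ l → M * l < (W + W′) * X) e
      (ℕ.<-≤-trans (count g (⊑-trans t K⊑L) qs (subst (0 <_) (≡-sym e) pos)) (ℕ.*-monoˡ-≤ X (ℕ.m≤n+m W′ W)))
  ... | ys@(_ ∷ _) , [] , s , _ , ps , _ , e =
    subst (λ l → M * l < (W + W′) * X) (trans (≡-sym (ℕ.+-identityʳ _)) e)
      (ℕ.<-≤-trans (count f (⊑-trans s K⊑L) ps (s≤s z≤n)) (ℕ.*-monoˡ-≤ X (ℕ.m≤m+n W W′)))
  ... | ys@(_ ∷ _) , zs@(_ ∷ _) , s , t , ps , qs , e = begin-strict
    M * length K               ≡⟨ cong (M *_) e ⟨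
    M * (length ys + length zs) ≡⟨ ℕ.*-distribˡ-+ M (length ys) (length zs) ⟩
    M * length ys + M * length zs <⟨ ℕ.+-mono-< (count f (⊑-trans s K⊑L) ps (s≤s z≤n)) (count g (⊑-trans t K⊑L) qs (s≤s z≤n)) ⟩
    W * X + W′ * X             ≡⟨ ℕ.*-distribʳ-+ X W W′ ⟨
    (W + W′) * X               ∎
    where open ≤-Reasoning

  infixr 5 _∪ᶠ_

  ⋃ᶠ : ∀ {M W} {B : Set} {P : B → Subset N → Set} (bs : List B) →
             (∀ {b} → b ∈ₗ bs → Fraction M W (P b)) → Fraction M (length bs * W) (λ S → ∃ λ b → b ∈ₗ bs × P b S)
  ⋃ᶠ [] fs = none λ { _ (_ , () , _) }
  ⋃ᶠ (b ∷ bs) fs = weaken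
    (λ { _ (_ , here refl , p) → inj₁ p ; _ (c , there c∈ , p) → inj₂ (c , c∈ , p) })
    (fs (here refl) ∪ᶠ ⋃ᶠ bs (λ b∈ → fs (there b∈)))

  -- If all S with property P agree outside A′, on a set C without edges to A′, then S ↦ S ∩ A′ is
  -- injective on them and has values that are maximal in A′.
  restrict : ∀ {M W k P} (A′ : Subset N) (C : Fin N → Set) → A′ ⊆ A → ∣ A′ ∣ + k ≤ ∣ A ∣ → 0 < k → Weight M k W →
             (∀ {x y} → C x → y ∈ A′ → ¬ (x ~ y)) →
             (∀ {S} → S ∈ₗ L → P S → (∀ {x} → x ∉ A′ → x ∈ S → C x) × (∀ {x} → x ∉ A′ → C x → x ∈ S)) →
             Fraction M W P
  count (restrict {M} {W} {k} {P} A′ C A′⊆A A′+k≤A k>0 w sep fixed) {K} K⊑L ps _ = ^5-cancel-< (begin-strict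
    (M * length K) ^ 5            ≡⟨ ^-distribʳ-* 5 M (length K) ⟩
    M ^ 5 * length K ^ 5          ≤⟨ ℕ.*-mono-≤ (bound w) K^5≤ ⟩
    W ^ 5 * 10 ^ k * 10 ^ ∣ A′ ∣   ≡⟨ ℕ.*-assoc (W ^ 5) _ _ ⟩
    W ^ 5 * (10 ^ k * 10 ^ ∣ A′ ∣) ≡⟨ cong (W ^ 5 *_) (ℕ.^-distribˡ-+-* 10 k ∣ A′ ∣) ⟨
    W ^ 5 * 10 ^ (k + ∣ A′ ∣)      ≤⟨ ℕ.*-monoʳ-≤ (W ^ 5) (ℕ.^-monoʳ-≤ 10 (≤-trans (≤-reflexive (ℕ.+-comm k _)) A′+k≤A)) ⟩
    -- The strictness of `Fraction` comes from `large`; `positive` keeps the factor `W ^ 5` from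
    -- vanishing.
    W ^ 5 * 10 ^ ∣ A ∣            <⟨ ℕ.*-monoʳ-< (W ^ 5) {{ℕ.m^n≢0 W 5 {{>-nonZero (positive w)}}}} large ⟩
    W ^ 5 * X ^ 5                ≡⟨ ^-distribʳ-* 5 W X ⟨
    (W * X) ^ 5                  ∎)
    where
    open ≤-Reasoning
    Fixed : Subset N → Set
    Fixed S = Maximal A S × (∀ {x} → x ∉ A′ → x ∈ S → C x) × (∀ {x} → x ∉ A′ → C x → x ∈ S)
    all-fixed : All Fixed K
    all-fixed = All.tabulate λ S∈K → let S∈L = ⊑-lookup K⊑L S∈K in ∈L⇒maximal S∈L , fixed S∈L (All.lookup ps S∈K)
    ⊆-fixed : ∀ {S T} → Fixed S → Fixed T → S ∩ A′ ≡ T ∩ A′ → S ⊆ T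
    ⊆-fixed {S} {T} (_ , S⇒C , _) (_ , _ , C⇒T) eq {x} x∈S with x ∈? A′
    ... | yes x∈A′ = p∩q⊆p T A′ (subst (x ∈_) eq (x∈p∩q⁺ (x∈S , x∈A′)))
    ... | no x∉A′ = C⇒T x∉A′ (S⇒C x∉A′ x∈S)
    K^5≤ : length K ^ 5 ≤ 10 ^ ∣ A′ ∣
    K^5≤ = subst (λ l → l ^ 5 ≤ 10 ^ ∣ A′ ∣) (length-map (_∩ A′) K) (ih
      (ℕ.<-≤-trans (ℕ.m<m+n ∣ A′ ∣ k>0) A′+k≤A)
      (unique-map (λ s t eq → ⊆-antisym (⊆-fixed s t eq) (⊆-fixed t s (≡-sym eq))) all-fixed (unique-⊑ K⊑L L!))
      (All.map⁺ (All.map (λ (m , S⇒C , _) → maximal-∩ A′⊆A (λ x∈S x∉A′ → sep (S⇒C x∉A′ x∈S)) m) all-fixed)))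

  -- Neighbourhoods and degrees within `A`

  abstract

    nbrs : Fin N → List (Fin N)
    nbrs v = filter (λ x → x ∈? A ×-dec v ~? x) (allFin N)

    nbrs! : ∀ v → Unique (nbrs v)
    nbrs! v = Unique.filter⁺ _ (Unique.allFin⁺ N)

    ∈-nbrs⁺ : ∀ {v x} → x ∈ A → v ~ x → x ∈ₗ nbrs v
    ∈-nbrs⁺ {v} {x} x∈A v~x = ∈-filter⁺ _ (∈-allFin x) (x∈A , v~x)

    ∈-nbrs⁻ : ∀ {v x} → x ∈ₗ nbrs v → x ∈ A × v ~ x
    ∈-nbrs⁻ {v} x∈ = proj₂ (∈-filter⁻ (λ x → x ∈? A ×-dec v ~? x) {xs = allFin N} x∈)

  deg : Fin N → ℕ
  deg v = length (nbrs v)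

  _∉-nbrs_ : Fin N → Fin N → List (Fin N)
  u ∉-nbrs v = filter (_≢? u) (nbrs v)

  ∈-∉-nbrs⁻ : ∀ {u v x} → x ∈ₗ u ∉-nbrs v → x ∈ₗ nbrs v × x ≢ u
  ∈-∉-nbrs⁻ {u} {v} x∈ = ∈-filter⁻ (_≢? u) {xs = nbrs v} x∈

  ∣∉-nbrs∣ : ∀ {u v} → u ∈ₗ nbrs v → length (u ∉-nbrs v) < deg v
  ∣∉-nbrs∣ {u} u∈ = filter-notAll (_≢? u) _ (Any.map (λ { refl ≢ → ≢ refl }) u∈)

  -- The part of N(u) outside N[v]: the vertices deleted beyond N[v] when `v` is matched with `u`.
  far-nbrs : Fin N → Fin N → List (Fin N)
  far-nbrs v u = filter (far? v) (nbrs u)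

  ∈-far-nbrs⁺ : ∀ {v u x} → x ∈ A → u ~ x → Far v x → x ∈ₗ far-nbrs v u
  ∈-far-nbrs⁺ {v} x∈A u~x far = ∈-filter⁺ (far? v) (∈-nbrs⁺ x∈A u~x) far

  ∈-far-nbrs⁻ : ∀ {v u x} → x ∈ₗ far-nbrs v u → x ∈ A × u ~ x × Far v x
  ∈-far-nbrs⁻ {v} {u} x∈ with ∈-filter⁻ (far? v) {xs = nbrs u} x∈
  ... | x∈nbrs , far with ∈-nbrs⁻ x∈nbrs
  ...   | x∈A , u~x = x∈A , u~x , far

  far-nbrs⊆nbrs : ∀ {v u x} → x ∈ₗ far-nbrs v u → x ∈ₗ nbrs u
  far-nbrs⊆nbrs {v} {u} x∈ = proj₁ (∈-filter⁻ (far? v) {xs = nbrs u} x∈)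

  far-nbrs! : ∀ v u → Unique (far-nbrs v u)
  far-nbrs! v u = Unique.filter⁺ (far? v) (nbrs! u)

  ∈-far-nbrs⇒Far : ∀ {v u x} → x ∈ₗ far-nbrs v u → Far v x
  ∈-far-nbrs⇒Far x∈ = proj₂ (proj₂ (∈-far-nbrs⁻ x∈))

  -- Deleting a closed neighbourhood N[C]

  Near : List (Fin N) → Fin N → Set
  Near C x = Any (λ c → x ≡ c ⊎ c ~ x) C

  far-from? : ∀ C → Decidable (λ x → x ∈ A × ¬ Near C x)
  far-from? C x = x ∈? A ×-dec ¬? (Any.any? (λ c → x Fin.≟ c ⊎-dec c ~? x) C)

  far-from⊆ : ∀ C → ⟦ far-from? C ⟧ ⊆ A
  far-from⊆ C x∈ = proj₁ (∈⟦⟧⁻ (far-from? C) x∈)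

  near⇒∉ : ∀ {C x} → Near C x → x ∉ ⟦ far-from? C ⟧
  near⇒∉ {C} near x∈ = proj₂ (∈⟦⟧⁻ (far-from? C) x∈) near

  ∉⇒near : ∀ {C x} → x ∈ A → x ∉ ⟦ far-from? C ⟧ → Near C x
  ∉⇒near {C} {x} x∈A x∉ with Any.any? (λ c → x Fin.≟ c ⊎-dec c ~? x) C
  ... | yes near = near
  ... | no ¬near = contradiction (∈⟦⟧⁺ (far-from? C) (x∈A , ¬near)) x∉

  -- Counted as deleted are `c`, its neighbours and the extra vertices `ys`, with no overlap because
  -- `ys` avoids N[c].
  ∣far-from∣ : ∀ {c C} → c ∈ A → c ∈ₗ C → (ys : List (Fin N)) → Unique ys →
               All (λ y → y ∈ A × Near C y × Far c y) ys → ∣ ⟦ far-from? C ⟧ ∣ + suc (deg c + length ys) ≤ ∣ A ∣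
  ∣far-from∣ {c} {C} c∈A c∈C ys ys! ys-far =
    subst (λ l → ∣ ⟦ far-from? C ⟧ ∣ + suc l ≤ ∣ A ∣) (length-++ (nbrs c))
      (∣p∣+length≤∣q∣ nbhd (far-from⊆ C) nbhd!
        ((c∈A , near⇒∉ (Any.map (λ { refl → inj₁ refl }) c∈C))
         ∷ All.++⁺
             (All.tabulate λ x∈ → proj₁ (∈-nbrs⁻ x∈) , near⇒∉ (Any.map (λ { refl → inj₂ (proj₂ (∈-nbrs⁻ x∈)) }) c∈C))
             (All.map (λ (y∈A , near , _) → y∈A , near⇒∉ near) ys-far)))
    where
    nbhd = c ∷ nbrs c ++ ys
    nbhd! : Unique nbhd
    nbhd! = All.++⁺ (All.tabulate λ x∈ → ~⇒≢ (proj₂ (∈-nbrs⁻ x∈))) (All.map (λ (_ , _ , y≢c , _) → y≢c ∘ ≡-sym) ys-far)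
          ∷ Unique.++⁺ (nbrs! c) ys! λ (x∈ , x∈ys) → proj₂ (proj₂ (proj₂ (All.lookup ys-far x∈ys))) (proj₂ (∈-nbrs⁻ x∈))

  -- A set in which `C` is closed meets N[C] exactly in `C`, so N[C] can be deleted without losing
  -- information. The vertex `c` and the list `ys` only bound the number of deleted vertices.
  closed-fraction : ∀ {M W k c C} → c ∈ A → c ∈ₗ C → (ys : List (Fin N)) → Unique ys →
                    All (λ y → y ∈ A × Near C y × Far c y) ys →
                    k ≤ suc (deg c + length ys) → Weight M k W → Fraction M W (Closed C)
  closed-fraction {C = C} c∈A c∈C ys ys! ys-far k≤ w =
    restrict ⟦ far-from? C ⟧ (_∈ₗ C) (far-from⊆ C) (∣far-from∣ c∈A c∈C ys ys! ys-far) (s≤s z≤n) (weight-mono k≤ w)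
      (λ x∈C y∈A′ x~y → near⇒∉ (Any.map (λ { refl → inj₂ x~y }) x∈C) y∈A′)
      (λ S∈L (C⊆S , closed) → near⇒∈ (∈L⇒maximal S∈L) closed , λ _ → C⊆S)
    where
    near⇒∈ : ∀ {S} → Maximal A S → (∀ {c y} → c ∈ₗ C → y ∈ S → c ~ y → y ∈ₗ C) →
             ∀ {x} → x ∉ ⟦ far-from? C ⟧ → x ∈ S → x ∈ₗ C
    near⇒∈ m closed x∉ x∈S with find (∉⇒near (⊆-ambient m x∈S) x∉)
    ... | _ , c∈C , inj₁ refl = c∈C
    ... | _ , c∈C , inj₂ c~x = closed c∈C x∈S c~x

  single-fraction : ∀ {v} → v ∈ A → ∀ {M k W} → k ≤ suc (deg v) → Weight M k W → Fraction M W (Single v)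
  single-fraction v∈A k≤ w = weaken (λ _ → single-closed)
    (closed-fraction v∈A (here refl) [] [] [] (≤-trans k≤ (s≤s (≤-reflexive (≡-sym (ℕ.+-identityʳ _))))) w)

  pair-fraction : ∀ {u x} → u ∈ A → ∀ {M k W} → k ≤ suc (deg u + length (far-nbrs u x)) →
                  Weight M k W → Fraction M W (Pair u x)
  pair-fraction {u} {x} u∈A k≤ w = weaken (λ S∈L → pair-closed (dissociated (∈L⇒maximal S∈L)))
    (closed-fraction u∈A (here refl) (far-nbrs u x) (far-nbrs! u x)
      (All.tabulate λ y∈ → let (y∈A , x~y , far) = ∈-far-nbrs⁻ y∈ in y∈A , there (here (inj₂ x~y)) , far) k≤ w)

  -- All of `S` survives the deletion of `v`, so the fixed part outside `A′` is empty and no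
  -- condition on edges arises.
  absent-fraction : ∀ {v} → v ∈ A → ∀ {M W} → Weight M 1 W → Fraction M W (v ∉_)
  absent-fraction {v} v∈A w = restrict A′ (λ _ → Falsum) (λ x∈ → proj₁ (∈⟦⟧⁻ A′? x∈))
    (∣p∣+length≤∣q∣ (v ∷ []) (λ x∈ → proj₁ (∈⟦⟧⁻ A′? x∈)) ([] ∷ []) ((v∈A , λ v∈A′ → proj₂ (∈⟦⟧⁻ A′? v∈A′) refl) ∷ []))
    (s≤s z≤n) w (λ ()) (λ S∈L v∉S → (λ {x} x∉A′ x∈S → x∉A′ (∈⟦⟧⁺ A′? (⊆-ambient (∈L⇒maximal S∈L) x∈S , λ { refl → v∉S x∈S }))) , λ _ ())
    where
    A′? = λ x → x ∈? A ×-dec ¬? (x Fin.≟ v)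
    A′ = ⟦ A′? ⟧

  -- Vertices of degree at least 4

  -- An edge of `S` at `v` is listed under its other end, as an edge meeting N(v), so a matched `v`
  -- and an absent `v` share one form.
  around : ∀ {v S} → v ∈ A → Maximal A S →
           Single v S ⊎ (∃ λ x → x ∈ₗ nbrs v × ∃ λ y → y ∈ₗ nbrs x × Pair x y S)
                      ⊎ (∃₂ λ x y → x ≢ y × x ∈ₗ nbrs v × y ∈ₗ nbrs v × Single x S × Single y S)
  around {v} {S} v∈A m with v ∈? S
  ... | yes v∈S with status v∈S
  ...   | inj₁ s = inj₁ s
  ...   | inj₂ (u , p@(_ , u∈S , v~u)) = inj₂ (inj₁ (u , ∈-nbrs⁺ (⊆-ambient m u∈S) v~u , v , ∈-nbrs⁺ v∈A (~-sym v~u) , Pair-sym p))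
  around {v} {S} v∈A m | no v∉S with blocked⇒near (maximal⇒blocked m v∈A v∉S)
  ... | inj₁ (x , y , v~x , p@(x∈S , y∈S , x~y)) =
    inj₂ (inj₁ (x , ∈-nbrs⁺ (⊆-ambient m x∈S) v~x , y , ∈-nbrs⁺ (⊆-ambient m y∈S) x~y , p))
  ... | inj₂ (x , y , x≢y , v~x , v~y , s , t) =
    inj₂ (inj₂ (x , y , x≢y , ∈-nbrs⁺ (⊆-ambient m (proj₁ s)) v~x , ∈-nbrs⁺ (⊆-ambient m (proj₁ t)) v~y , s , t))

  single⇒far-nbr : ∀ {v u S} → u ∈ₗ nbrs v → Maximal A S → Single v S → ∃ λ x → x ∈ₗ far-nbrs v u × Single v S × x ∈ S
  single⇒far-nbr u∈ m s with ∈-nbrs⁻ u∈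
  ... | u∈A , v~u with single⇒far m s u∈A v~u
  ...   | x , x∈S , u~x , far = x , ∈-far-nbrs⁺ (⊆-ambient m x∈S) u~x far , s , x∈S

  -- An isolated `v` cannot block `u` on its own, and `u` has no neighbour outside N[v] that could
  -- help.
  no-single : ∀ {v u M} → u ∈ₗ nbrs v → far-nbrs v u ≡ [] → Fraction M 0 (Single v)
  no-single u∈ eq = none λ m s → let (x , x∈ , _) = single⇒far-nbr u∈ m s in case subst (x ∈ₗ_) eq x∈ of λ ()

  PairedWith : List (Fin N) → Fin N → Subset N → Set
  PairedWith us v S = ∃ λ u → u ∈ₗ us × Pair v u S

  star : ∀ {v M W₀ W₁ W₂} → v ∈ A → Weight M 1 W₀ → Fraction M W₁ (Single v) → Fraction M W₂ (PairedWith (nbrs v) v) →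
         W₀ + (W₁ + W₂) ≤ M → Falsum
  star {v} v∈A w f g W≤M = conclude (absent-fraction v∈A w ∪ᶠ f ∪ᶠ g) W≤M cover
    where
    cover : ∀ {S} → Maximal A S → v ∉ S ⊎ Single v S ⊎ PairedWith (nbrs v) v S
    cover {S} m with v ∈? S
    ... | no v∉S = inj₁ v∉S
    ... | yes v∈S with status v∈S
    ...   | inj₁ s = inj₂ (inj₁ s)
    ...   | inj₂ (u , p@(_ , u∈S , v~u)) = inj₂ (inj₂ (u , ∈-nbrs⁺ (⊆-ambient m u∈S) v~u , p))

  -- N[u] ∩ A ⊆ N[v].
  Inner : Fin N → Fin N → Set
  Inner v u = far-nbrs v u ≡ []

  inner? : ∀ v → Decidable (Inner v)
  inner? v u with far-nbrs v u
  ... | [] = yes refl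
  ... | _ ∷ _ = no λ ()

  outer⇒1≤ : ∀ {v u} → ¬ Inner v u → 1 ≤ length (far-nbrs v u)
  outer⇒1≤ {v} {u} out with far-nbrs v u
  ... | [] = contradiction refl out
  ... | _ ∷ _ = s≤s z≤n

  size : ∀ {v u d} → deg v ≡ d → suc d ≤ suc (deg v + length (far-nbrs v u))
  size refl = s≤s (ℕ.m≤m+n _ _)

  outer-size : ∀ {v u d} → deg v ≡ d → ¬ Inner v u → 2 + d ≤ suc (deg v + length (far-nbrs v u))
  outer-size {v} refl outer = s≤s (≤-trans (≤-reflexive (ℕ.+-comm 1 (deg v))) (ℕ.+-monoʳ-≤ (deg v) (outer⇒1≤ outer)))

  -- The degree 5 + j is unbounded, so the denominator `M` grows linearly with it while each pair
  -- keeps a constant weight.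
  deg≤4 : ∀ {v} → v ∈ A → deg v ≤ 4
  deg≤4 {v} v∈A with deg v ≤? 4
  ... | yes ≤4 = ≤4
  ... | no ≰4 with ℕ.m≤n⇒∃[o]m+o≡n (ℕ.≰⇒> ≰4)
  ...   | j , 5+j≡deg with Any.any? (inner? v) (nbrs v)
  ...     | yes some with find some
  -- An inner neighbour rules out an isolated `v`. What `v ∉ S` leaves, 369 of every 1000, is shared
  -- equally by the 5 + j neighbours.
  ...       | u , u∈ , inner = ⊥-elim (star v∈A (weight-scale {1000} (5 + j) (cw-weight 1)) (no-single u∈ inner)
    (⋃ᶠ (nbrs v) λ _ → pair-fraction v∈A (size refl)
      (subst (λ d → Weight (1000 * (5 + j)) (suc d) 369) 5+j≡deg (weight-grow {1000} {6} 3 j (weight ≤! ≤!))))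
    (≤-reflexive (subst (λ d → 631 * (5 + j) + d * 369 ≡ 1000 * (5 + j)) 5+j≡deg
      (solve 1 (λ j → con 631 :* (con 5 :+ j) :+ (con 5 :+ j) :* con 369 := con 1000 :* (con 5 :+ j)) refl j))))
  -- All neighbours are outer, so each pair deletes one more vertex. At j = 0 the total is 3786 +
  -- 738 + 5 * 295 = 5999 out of 6000, and every further neighbour adds 926 against 1000.
  deg≤4 {v} v∈A | no ≰4 | j , 5+j≡deg | no ¬some = ⊥-elim (star v∈A (weight-scale {1000} (6 + j) (cw-weight 1))
    (single-fraction v∈A ≤-refl (subst (λ d → Weight (1000 * (6 + j)) (suc d) 738) 5+j≡deg (weight-grow {1000} {6} 4 j (weight ≤! ≤!))))
    (⋃ᶠ (nbrs v) λ u∈ → pair-fraction v∈A (outer-size refl λ inner → ¬some (lose u∈ inner))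
      (subst (λ d → Weight (1000 * (6 + j)) (2 + d) 295) 5+j≡deg (weight-grow {1000} {7} 4 j (weight ≤! ≤!))))
    (subst (λ d → 631 * (6 + j) + (738 + d * 295) ≤ 1000 * (6 + j)) {y = deg v} 5+j≡deg (≤-trans (ℕ.m≤m+n _ (1 + 74 * j))
      (≤-reflexive (solve 1 (λ j → con 631 :* (con 6 :+ j) :+ (con 738 :+ (con 5 :+ j) :* con 295) :+ (con 1 :+ con 74 :* j)
        := con 1000 :* (con 6 :+ j)) refl j)))))

  -- If all neighbours are inner, N[v] is a union of components of G[A], so a set S avoiding v meets N(v) in a
  -- maximal set of G[N(v)], of which there are at most m by the induction hypothesis. Here it matters that m is
  -- an integer: m = 6 < 10^(4/5) makes K₅ come out as exactly 4 + 6.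
  not-all-inner : ∀ {v} m → v ∈ A → 0 < deg v → (∀ l → l ^ 5 ≤ 10 ^ deg v → l ≤ m) →
                  (deg v + m) * cw (suc (deg v)) ≤ 1000 → ¬ All (Inner v) (nbrs v)
  not-all-inner {v} m v∈A 0<deg l≤m W≤1000 all-inner =
    conclude (single ∪ᶠ pairs ∪ᶠ absent) W≤ cover
    where
    W = cw (suc (deg v))
    B? = λ x → x ∈? A ×-dec v ~? x
    B = ⟦ B? ⟧
    B⊆A : B ⊆ A
    B⊆A x∈B = proj₁ (∈⟦⟧⁻ B? x∈B)
    ∣B∣<∣A∣ : ∣ B ∣ < ∣ A ∣
    ∣B∣<∣A∣ = ≤-trans (≤-reflexive (ℕ.+-comm 1 _)) (∣p∣+length≤∣q∣ (v ∷ []) B⊆A ([] ∷ [])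
      ((v∈A , λ v∈B → ~-irrefl (proj₂ (∈⟦⟧⁻ B? v∈B))) ∷ []))
    ∣B∣≤deg : ∣ B ∣ ≤ deg v
    ∣B∣≤deg = ∣p∣≤length (nbrs v) λ x∈B → let (x∈A , v~x) = ∈⟦⟧⁻ B? x∈B in ∈-nbrs⁺ x∈A v~x
    nbr-closed : ∀ {x y} → y ∈ B → x ∈ A → y ~ x → ¬ Far v x
    nbr-closed {x} y∈B x∈A y~x far with ∈⟦⟧⁻ B? y∈B
    ... | y∈A , v~y = case subst (x ∈ₗ_) (All.lookup all-inner (∈-nbrs⁺ y∈A v~y)) (∈-far-nbrs⁺ x∈A y~x far) of λ ()
    not-far : ∀ {S x} → v ∉ S → x ∈ S → x ∈ A → ¬ Far v x → x ∈ B
    not-far {x = x} v∉S x∈S x∈A ¬far with v ~? x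
    ... | yes v~x = ∈⟦⟧⁺ B? (x∈A , v~x)
    ... | no v≁x = contradiction ((λ { refl → v∉S x∈S }) , v≁x) ¬far
    _≟_ = Vec.≡-dec Bool._≟_
    avoiding? : Decidable (v ∉_)
    avoiding? S = ¬? (v ∈? S)
    -- The traces on N(v) of the sets avoiding `v`, each kept once, since every trace becomes one
    -- case of the cover.
    Cs = deduplicate _≟_ (map (_∩ B) (filter avoiding? L))
    Cs-maximal : All (Maximal B) Cs
    Cs-maximal = All.deduplicate⁺ _≟_ (All.map⁺ (All.tabulate λ S∈ →
      let (S∈L , v∉S) = ∈-filter⁻ avoiding? {xs = L} S∈ ; max = ∈L⇒maximal S∈L in
      maximal-∩ B⊆A (λ x∈S x∉B y∈B x~y →
        x∉B (not-far v∉S x∈S (⊆-ambient max x∈S) (nbr-closed y∈B (⊆-ambient max x∈S) (~-sym x~y)))) max))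
    ∣Cs∣≤m : length Cs ≤ m
    ∣Cs∣≤m = l≤m (length Cs) (≤-trans (ih ∣B∣<∣A∣ (DecUnique.deduplicate-! _≟_ _) Cs-maximal) (ℕ.^-monoʳ-≤ 10 ∣B∣≤deg))
    single : Fraction 1000 0 (Single v)
    single = let (_ , u∈) = 0<length⇒∃∈ 0<deg in no-single u∈ (All.lookup all-inner u∈)
    pairs : Fraction 1000 (deg v * W) (PairedWith (nbrs v) v)
    pairs = ⋃ᶠ (nbrs v) λ _ → pair-fraction v∈A (size refl) (cw-weight (suc (deg v)))
    absent : Fraction 1000 (length Cs * W) (v ∉_)
    absent = weaken
      (λ {S} S∈L v∉S → S ∩ B , ∈-deduplicate⁺ _≟_ (∈-map⁺ (_∩ B) (∈-filter⁺ avoiding? S∈L v∉S)) , v∉S , refl)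
      (⋃ᶠ {P = λ C S → v ∉ S × S ∩ B ≡ C} Cs λ {C} C∈Cs →
        restrict ⟦ far-from? (v ∷ []) ⟧ (_∈ C) (far-from⊆ (v ∷ []))
          (subst (λ d → ∣ ⟦ far-from? (v ∷ []) ⟧ ∣ + suc d ≤ ∣ A ∣) (ℕ.+-identityʳ (deg v)) (∣far-from∣ {C = v ∷ []} v∈A (here refl) [] [] []))
          (s≤s z≤n) (cw-weight (suc (deg v)))
          (λ x∈C y∈ x~y → nbr-closed (⊆-ambient (All.lookup Cs-maximal C∈Cs) x∈C) (far-from⊆ (v ∷ []) y∈) x~y
            ((λ { refl → near⇒∉ {v ∷ []} (here (inj₁ refl)) y∈ }) , λ v~y → near⇒∉ {v ∷ []} (here (inj₂ v~y)) y∈))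
          λ { {S} S∈L (v∉S , refl) →
              (λ x∉ x∈S → let x∈A = ⊆-ambient (∈L⇒maximal S∈L) x∈S in
                x∈p∩q⁺ (x∈S , not-far v∉S x∈S x∈A λ (x≢v , v≁x) →
                  case ∉⇒near {v ∷ []} x∈A x∉ of λ { (here (inj₁ x≡v)) → x≢v x≡v ; (here (inj₂ v~x)) → v≁x v~x }))
              , λ _ x∈C → p∩q⊆p S B x∈C })
    W≤ : deg v * W + length Cs * W ≤ 1000
    W≤ = ≤-trans (≤-reflexive (≡-sym (ℕ.*-distribʳ-+ W (deg v) (length Cs))))
      (≤-trans (ℕ.*-monoˡ-≤ W (ℕ.+-monoʳ-≤ (deg v) ∣Cs∣≤m)) W≤1000)
    cover : ∀ {S} → Maximal A S → Single v S ⊎ PairedWith (nbrs v) v S ⊎ v ∉ S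
    cover {S} max with v ∈? S
    ... | no v∉S = inj₂ (inj₂ v∉S)
    ... | yes v∈S with status v∈S
    ...   | inj₁ s = inj₁ s
    ...   | inj₂ (u , p@(_ , u∈S , v~u)) = inj₂ (inj₁ (u , ∈-nbrs⁺ (⊆-ambient max u∈S) v~u , p))

  enlarge : ∀ {M W W′ P} → W ≤ W′ → Fraction M W P → Fraction M W′ P
  enlarge W≤W′ f = fraction λ K⊑L ps pos → ℕ.<-≤-trans (count f K⊑L ps pos) (ℕ.*-monoˡ-≤ X W≤W′)

  abstract

    deg≤3 : ∀ {v} → v ∈ A → deg v ≤ 3
    deg≤3 {v} v∈A with deg v ℕ.≟ 4
    ... | no ≢4 = ℕ.≤-pred (ℕ.≤∧≢⇒< (deg≤4 v∈A) ≢4)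
    ... | yes ≡4 with All.all? (inner? v) (nbrs v)
    ...   | yes all-inner = contradiction all-inner (not-all-inner 6 v∈A (subst (0 <_) (≡-sym ≡4) ≤!)
      -- 7^5 = 16807 exceeds 10^4, so 6 is the integer part of 10^(4/5).
      (λ l l^5≤ → ℕ.≮⇒≥ λ 7≤l → ℕ.<⇒≱ (≤! {10001} {7 ^ 5}) (≤-trans (ℕ.^-monoˡ-≤ 5 7≤l) (subst (λ d → l ^ 5 ≤ 10 ^ d) ≡4 l^5≤)))
      (subst (λ d → (d + 6) * cw (suc d) ≤ 1000) (≡-sym ≡4) ≤!))
    ...   | no ¬all-inner with find (All.¬All⇒Any¬ (inner? v) (nbrs v) ¬all-inner)
    ...     | u , u∈ , outer with Any.any? (inner? v) (nbrs v)
    ...       | yes some with find some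
    -- Pairing `v` with the outer `u` deletes 6 vertices, with one of at most three others 5: 631 +
    -- 64 + 3 * 100 = 995.
    ...         | x , x∈ , inner = ⊥-elim (star v∈A (cw-weight 1) (no-single x∈ inner)
      (weaken (λ _ (y , y∈ , p) → case y Fin.≟ u of λ { (yes refl) → inj₁ p ; (no y≢u) → inj₂ (y , ∈-filter⁺ (_≢? u) y∈ y≢u , p) })
        (pair-fraction v∈A (outer-size ≡4 outer) (cw-weight 6)
         ∪ᶠ ⋃ᶠ (u ∉-nbrs v) λ _ → pair-fraction v∈A (size ≡4) (cw-weight 5)))
      (≤-trans (ℕ.+-monoʳ-≤ 695 (ℕ.*-monoˡ-≤ 100 (ℕ.≤-pred (subst (length (u ∉-nbrs v) <_) ≡4 (∣∉-nbrs∣ u∈))))) ≤!))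
    -- Without inner neighbours the total is 631 + 100 + 4 * 64 = 987.
    deg≤3 {v} v∈A | yes ≡4 | no _ | _ | no ¬some = ⊥-elim (star v∈A (cw-weight 1)
      (single-fraction v∈A (≤-reflexive (cong suc (≡-sym ≡4))) (cw-weight 5))
      (⋃ᶠ (nbrs v) λ u∈ → pair-fraction v∈A (outer-size ≡4 λ inner → ¬some (lose u∈ inner)) (cw-weight 6))
      (subst (λ d → 631 + (100 + d * 64) ≤ 1000) {y = deg v} (≡-sym ≡4) ≤!))

  -- Vertices of degree at most 2

  deg≢0 : ∀ {v} → v ∈ A → deg v ≢ 0
  deg≢0 {v} v∈A ≡0 = conclude (single-fraction v∈A {k = 1} (s≤s z≤n) (cw-weight 1)) ≤! cover
    where
    no-nbr : ∀ {x} → x ∉ₗ nbrs v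
    no-nbr x∈ = case subst (_ ∈ₗ_) (length≡0 ≡0) x∈ of λ ()
    cover : ∀ {S} → Maximal A S → Single v S
    cover m with around v∈A m
    ... | inj₁ s = s
    ... | inj₂ (inj₁ (_ , x∈ , _)) = contradiction x∈ no-nbr
    ... | inj₂ (inj₂ (_ , _ , _ , x∈ , _)) = contradiction x∈ no-nbr

  -- Two isolated vertices do not fit into N(v), so `v` is isolated in `S` or its neighbour `u` is
  -- matched. The worst case is deg u = 2, with 399 + 2 * 252 = 903.
  deg≢1 : ∀ {v} → v ∈ A → deg v ≢ 1
  deg≢1 {v} v∈A ≡1 with length≡1 (nbrs v) ≡1
  ... | u , eq = conclude
    (single-fraction v∈A (≤-reflexive (cong suc (≡-sym ≡1))) (cw-weight 2)
     ∪ᶠ ⋃ᶠ (nbrs u) λ _ → pair-fraction u∈A (size refl) (cw-weight (suc (deg u))))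
    (small (deg u) (deg≤3 u∈A)) cover
    where
    only-nbr : ∀ {x} → x ∈ₗ nbrs v → x ≡ u
    only-nbr x∈ with subst (_ ∈ₗ_) eq x∈
    ... | here x≡u = x≡u
    u∈A : u ∈ A
    u∈A = proj₁ (∈-nbrs⁻ (subst (u ∈ₗ_) (≡-sym eq) (here refl)))
    small : ∀ p → p ≤ 3 → 399 + p * cw (suc p) ≤ 1000
    small 0 _ = ≤!
    small 1 _ = ≤!
    small 2 _ = ≤!
    small 3 _ = ≤!
    small (suc (suc (suc (suc _)))) (s≤s (s≤s (s≤s ())))
    cover : ∀ {S} → Maximal A S → Single v S ⊎ PairedWith (nbrs u) u S
    cover m with around v∈A m
    ... | inj₁ s = inj₁ s
    ... | inj₂ (inj₁ (x , x∈ , y , y∈ , p)) with only-nbr x∈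
    ...   | refl = inj₂ (y , y∈ , p)
    cover m | inj₂ (inj₂ (x , y , x≢y , x∈ , y∈ , _)) = contradiction (trans (only-nbr x∈) (≡-sym (only-nbr y∈))) x≢y

  abstract

    2≤deg : ∀ {v} → v ∈ A → 2 ≤ deg v
    2≤deg v∈A = ℕ.≤∧≢⇒< (ℕ.≤∧≢⇒< z≤n (deg≢0 v∈A ∘ ≡-sym)) (deg≢1 v∈A ∘ ≡-sym)

  -- `x` is isolated in `S` or matched with one of its r neighbours outside N[v]. Each of these 1 +
  -- r cases deletes N[v], `x` and those r vertices, 4 + r in all; the worst is r = 1 with 2 * 100.
  single-and-fraction : ∀ {v x} → v ∈ A → deg v ≡ 2 → x ∈ A → Far v x → Fraction 1000 200 (λ S → Single v S × x ∈ S)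
  single-and-fraction {v} {x} v∈A ≡2 x∈A far = enlarge (small r r≤3) (weaken (λ S∈L → cover (∈L⇒maximal S∈L))
    (closed-fraction v∈A (here refl) (x ∷ R) R! R-near k≤ (cw-weight (4 + r))
     ∪ᶠ ⋃ᶠ {P = λ y → Closed (v ∷ x ∷ y ∷ [])} R λ _ →
      closed-fraction v∈A (here refl) (x ∷ R) R! R-near k≤ (cw-weight (4 + r))))
    where
    R = far-nbrs v x
    r = length R
    R! : Unique (x ∷ R)
    R! = All.tabulate (λ y∈ → ~⇒≢ (proj₁ (proj₂ (∈-far-nbrs⁻ y∈)))) ∷ far-nbrs! v x
    R-near : ∀ {zs} → All (λ y → y ∈ A × Near (v ∷ x ∷ zs) y × Far v y) (x ∷ R)
    R-near = (x∈A , there (here (inj₁ refl)) , far) ∷ All.tabulate λ y∈ →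
      let (y∈A , x~y , far-y) = ∈-far-nbrs⁻ y∈ in y∈A , there (here (inj₂ x~y)) , far-y
    k≤ : 4 + r ≤ suc (deg v + suc r)
    k≤ = ≤-reflexive (≡-sym (cong (λ d → suc (d + suc r)) ≡2))
    r≤3 : r ≤ 3
    r≤3 = ≤-trans (length-filter (far? v) (nbrs x)) (deg≤3 x∈A)
    small : ∀ r → r ≤ 3 → cw (4 + r) + r * cw (4 + r) ≤ 200
    small 0 _ = ≤!
    small 1 _ = ≤!
    small 2 _ = ≤!
    small 3 _ = ≤!
    small (suc (suc (suc (suc _)))) (s≤s (s≤s (s≤s ())))
    cover : ∀ {S} → Maximal A S → Single v S × x ∈ S →
            Closed (v ∷ x ∷ []) S ⊎ ∃ λ y → y ∈ₗ R × Closed (v ∷ x ∷ y ∷ []) S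
    cover m (s , x∈S) with status x∈S
    ... | inj₁ t = inj₁ (++-closed (single-closed s) (single-closed t))
    ... | inj₂ (y , p@(_ , y∈S , x~y)) =
      inj₂ (y , ∈-far-nbrs⁺ (⊆-ambient m y∈S) x~y ((λ { refl → proj₂ far (~-sym x~y) }) , proj₂ s y∈S)
           , ++-closed (single-closed s) (pair-closed (dissociated m) p))

  module Degree2 {v u w} (v∈A : v ∈ A) (nbrs-v : nbrs v ≡ u ∷ w ∷ []) where

    ≡2 : deg v ≡ 2
    ≡2 = cong length nbrs-v

    nbr-cases : ∀ {x} → x ∈ₗ nbrs v → x ≡ u ⊎ x ≡ w
    nbr-cases x∈ with subst (_ ∈ₗ_) nbrs-v x∈
    ... | here x≡u = inj₁ x≡u
    ... | there (here x≡w) = inj₂ x≡w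

    u∈nbrs : u ∈ₗ nbrs v
    u∈nbrs = subst (u ∈ₗ_) (≡-sym nbrs-v) (here refl)
    w∈nbrs : w ∈ₗ nbrs v
    w∈nbrs = subst (w ∈ₗ_) (≡-sym nbrs-v) (there (here refl))
    u∈A : u ∈ A
    u∈A = proj₁ (∈-nbrs⁻ u∈nbrs)
    w∈A : w ∈ A
    w∈A = proj₁ (∈-nbrs⁻ w∈nbrs)
    v~u : v ~ u
    v~u = proj₂ (∈-nbrs⁻ u∈nbrs)
    v~w : v ~ w
    v~w = proj₂ (∈-nbrs⁻ w∈nbrs)
    u≢w : u ≢ w
    u≢w with subst Unique nbrs-v (nbrs! v)
    ... | (u≢w ∷ _) ∷ _ = u≢w

    -- An isolated `v` needs a vertex of `S` among the neighbours of `u` outside N[v]. This beats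
    -- the plain weight 252 when there is at most one such neighbour.
    single-via-u : Fraction 1000 (length (far-nbrs v u) * 200) (Single v)
    single-via-u = weaken (λ S∈L → single⇒far-nbr u∈nbrs (∈L⇒maximal S∈L))
      (⋃ᶠ {P = λ x S → Single v S × x ∈ S} (far-nbrs v u) λ x∈ →
        let (x∈A , _ , far) = ∈-far-nbrs⁻ x∈ in single-and-fraction v∈A ≡2 x∈A far)

    -- Adjacent `u` and `w` cannot both be isolated in `S`. As `u` has at most deg u - 2 neighbours
    -- outside N[v], the first two cases weigh at most 200 + 477 = 677, and the remaining edges at
    -- `w` at most 2 * 159 = 318.
    not-triangle : ¬ (u ~ w)
    not-triangle u~w = conclude
      (single-via-u
       ∪ᶠ ⋃ᶠ (nbrs u) (λ _ → pair-fraction u∈A (size refl) (cw-weight (suc (deg u))))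
       -- The edge between `u` and `w` is already counted at `u`.
       ∪ᶠ ⋃ᶠ (u ∉-nbrs w) (λ _ → pair-fraction w∈A (size refl) (cw-weight (suc (deg w)))))
      (≤-trans (≤-reflexive (≡-sym (ℕ.+-assoc (length (far-nbrs v u) * 200) _ _)))
        (≤-trans (ℕ.+-mono-≤ (small₁ 2+far≤ (deg≤3 u∈A)) (small₂ (∣∉-nbrs∣ (∈-nbrs⁺ u∈A (~-sym u~w))) (deg≤3 w∈A))) ≤!)) cover
      where
      2+far≤ : 2 + length (far-nbrs v u) ≤ deg u
      2+far≤ = unique-⊆⇒length≤ {xs = v ∷ w ∷ far-nbrs v u}
        ((~⇒≢ v~w ∷ All.tabulate λ x∈ → proj₁ (∈-far-nbrs⇒Far x∈) ∘ ≡-sym)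
         ∷ All.tabulate (λ { x∈ refl → proj₂ (∈-far-nbrs⇒Far x∈) v~w })
         ∷ far-nbrs! v u)
        λ { (here refl) → ∈-nbrs⁺ v∈A (~-sym v~u)
          ; (there (here refl)) → ∈-nbrs⁺ w∈A u~w
          ; (there (there x∈)) → far-nbrs⊆nbrs x∈ }
      small₁ : ∀ {f p} → 2 + f ≤ p → p ≤ 3 → f * 200 + p * cw (suc p) ≤ 677
      small₁ {0} {2} _ _ = ≤!
      small₁ {0} {3} _ _ = ≤!
      small₁ {1} {3} _ _ = ≤!
      small₁ {_} {suc (suc (suc (suc _)))} _ (s≤s (s≤s (s≤s ())))
      small₁ {suc _} {2} (s≤s (s≤s ())) _
      small₁ {suc (suc _)} {3} (s≤s (s≤s (s≤s ()))) _
      small₁ {_} {1} (s≤s ()) _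
      small₂ : ∀ {l q} → l < q → q ≤ 3 → l * cw (suc q) ≤ 318
      small₂ {0} _ _ = z≤n
      small₂ {1} {2} _ _ = ≤!
      small₂ {1} {3} _ _ = ≤!
      small₂ {2} {3} _ _ = ≤!
      small₂ {_} {suc (suc (suc (suc _)))} _ (s≤s (s≤s (s≤s ())))
      small₂ {suc _} {1} (s≤s ()) _
      small₂ {suc (suc _)} {2} (s≤s (s≤s ())) _
      small₂ {suc (suc (suc _))} {3} (s≤s (s≤s (s≤s ()))) _
      cover : ∀ {S} → Maximal A S → Single v S ⊎ PairedWith (nbrs u) u S ⊎ PairedWith (u ∉-nbrs w) w S
      cover m with around v∈A m
      ... | inj₁ s = inj₁ s
      ... | inj₂ (inj₁ (x , x∈ , y , y∈ , p)) with nbr-cases x∈ | y Fin.≟ u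
      ...   | inj₁ refl | _ = inj₂ (inj₁ (y , y∈ , p))
      ...   | inj₂ refl | yes refl = inj₂ (inj₁ (w , ∈-nbrs⁺ w∈A u~w , Pair-sym p))
      ...   | inj₂ refl | no y≢u = inj₂ (inj₂ (y , ∈-filter⁺ (_≢? u) y∈ y≢u , p))
      cover m | inj₂ (inj₂ (x , y , x≢y , x∈ , y∈ , s , t)) with nbr-cases x∈ | nbr-cases y∈
      ... | inj₁ refl | inj₁ refl = contradiction refl x≢y
      ... | inj₂ refl | inj₂ refl = contradiction refl x≢y
      ... | inj₁ refl | inj₂ refl = contradiction u~w (proj₂ s (proj₁ t))
      ... | inj₂ refl | inj₁ refl = contradiction u~w (proj₂ t (proj₁ s))

  no-triangle : ∀ {v x y} → v ∈ A → deg v ≡ 2 → x ∈ₗ nbrs v → y ∈ₗ nbrs v → ¬ (x ~ y)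
  no-triangle {v} v∈A deg≡2 x∈ y∈ x~y with length≡2 (nbrs v) deg≡2
  ... | u , w , eq with Degree2.nbr-cases v∈A eq x∈ | Degree2.nbr-cases v∈A eq y∈
  ...   | inj₁ refl | inj₁ refl = ~-irrefl x~y
  ...   | inj₁ refl | inj₂ refl = Degree2.not-triangle v∈A eq x~y
  ...   | inj₂ refl | inj₁ refl = Degree2.not-triangle v∈A eq (~-sym x~y)
  ...   | inj₂ refl | inj₂ refl = ~-irrefl x~y

  -- If N[y] ⊆ N[u], then deg u ≤ 3 leaves y with u and one common neighbour of u and y, a triangle at a vertex of degree 2.
  outer-nbr : ∀ {v u w y} → v ∈ A → u ∈ A → w ∈ A → v ~ u → v ~ w → u ≢ w → ¬ (u ~ w) →
              (∀ {x} → x ∈ₗ nbrs v → x ≡ u ⊎ x ≡ w) → y ∈ₗ nbrs u → ¬ Inner u y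
  outer-nbr {v} {u} {w} {y} v∈A u∈A w∈A v~u v~w u≢w u≁w nbr-cases y∈ inner with y Fin.≟ v
  ... | yes refl = case subst (w ∈ₗ_) inner (∈-far-nbrs⁺ w∈A v~w (u≢w ∘ ≡-sym , u≁w)) of λ ()
  ... | no y≢v = triangle
    where
    y∈A = proj₁ (∈-nbrs⁻ y∈)
    u~y = proj₂ (∈-nbrs⁻ y∈)
    u-adj : ∀ {x} → x ∈ₗ nbrs y → x ≢ u → u ~ x
    u-adj {x} x∈ x≢u with u ~? x | ∈-nbrs⁻ x∈
    ... | yes u~x | _ = u~x
    ... | no u≁x | x∈A , y~x = case subst (x ∈ₗ_) inner (∈-far-nbrs⁺ x∈A y~x (x≢u , u≁x)) of λ ()
    v≁y : ¬ (v ~ y)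
    v≁y v~y with nbr-cases (∈-nbrs⁺ y∈A v~y)
    ... | inj₁ refl = ~-irrefl u~y
    ... | inj₂ refl = u≁w u~y
    2+≤ : 2 + length (u ∉-nbrs y) ≤ deg u
    2+≤ = unique-⊆⇒length≤ {xs = v ∷ y ∷ (u ∉-nbrs y)}
      ((y≢v ∘ ≡-sym ∷ All.tabulate λ { x∈ refl → v≁y (~-sym (proj₂ (∈-nbrs⁻ (proj₁ (∈-∉-nbrs⁻ x∈))))) })
       ∷ All.tabulate (λ { x∈ refl → ~-irrefl (proj₂ (∈-nbrs⁻ (proj₁ (∈-∉-nbrs⁻ x∈)))) })
       ∷ Unique.filter⁺ (_≢? u) (nbrs! y))
      λ { (here refl) → ∈-nbrs⁺ v∈A (~-sym v~u)
        ; (there (here refl)) → y∈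
        ; (there (there x∈)) → let (x∈nbrs , x≢u) = ∈-∉-nbrs⁻ x∈ in
            ∈-nbrs⁺ (proj₁ (∈-nbrs⁻ x∈nbrs)) (u-adj x∈nbrs x≢u) }
    deg-y≤ : deg y ≤ suc (length (u ∉-nbrs y))
    deg-y≤ = unique-⊆⇒length≤ {ys = u ∷ (u ∉-nbrs y)} (nbrs! y) λ {x} x∈ → case x Fin.≟ u of λ
      { (yes refl) → here refl ; (no x≢u) → there (∈-filter⁺ (_≢? u) x∈ x≢u) }
    deg-y≤2 : deg y ≤ 2
    deg-y≤2 = ≤-trans deg-y≤ (ℕ.≤-pred (≤-trans 2+≤ (deg≤3 u∈A)))
    other : ∃ (_∈ₗ (u ∉-nbrs y))
    other = 0<length⇒∃∈ (ℕ.≤-pred (≤-trans (2≤deg y∈A) deg-y≤))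
    triangle : Falsum
    triangle with other
    ... | x , x∈ with ∈-∉-nbrs⁻ x∈
    ...   | x∈nbrs , x≢u = no-triangle y∈A (ℕ.≤-antisym deg-y≤2 (2≤deg y∈A)) (∈-nbrs⁺ u∈A (~-sym u~y)) x∈nbrs (u-adj x∈nbrs x≢u)

  -- Vertices of degree 2 lie in no triangle, which makes every pair at `u` or `w` delete a vertex
  -- beyond the closed neighbourhood. The worst total is 200 + 318 + 318 + 159 = 995, for deg u =
  -- deg w = 2.
  deg≢2 : ∀ {v} → v ∈ A → deg v ≢ 2
  deg≢2 {v} v∈A deg≡2 with length≡2 (nbrs v) deg≡2
  ... | u , w , eq = conclude
    (single
     ∪ᶠ ⋃ᶠ (nbrs u) (λ y∈ → pair-fraction u∈A
       (outer-size refl (outer-nbr v∈A u∈A w∈A v~u v~w u≢w not-triangle nbr-cases y∈)) (cw-weight (2 + deg u)))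
     ∪ᶠ ⋃ᶠ (nbrs w) (λ y∈ → pair-fraction w∈A
       (outer-size refl (outer-nbr v∈A w∈A u∈A v~w v~u (u≢w ∘ ≡-sym) (not-triangle ∘ ~-sym) (swap ∘ nbr-cases) y∈)) (cw-weight (2 + deg w)))
     ∪ᶠ both)
    (small (deg u) (deg w) (2≤deg u∈A) (deg≤3 u∈A) (deg≤3 w∈A)) cover
    where
    open Degree2 v∈A eq
    -- For deg u = 2 the bound through `u` matters: with 252 the worst total would be 1047.
    single-weight : ℕ → ℕ
    single-weight 2 = 200
    single-weight _ = 252
    1+far≤ : 1 + length (far-nbrs v u) ≤ deg u
    1+far≤ = unique-⊆⇒length≤ {xs = v ∷ far-nbrs v u}
      (All.tabulate (λ x∈ → proj₁ (∈-far-nbrs⇒Far x∈) ∘ ≡-sym) ∷ far-nbrs! v u)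
      λ { (here refl) → ∈-nbrs⁺ v∈A (~-sym v~u) ; (there x∈) → far-nbrs⊆nbrs x∈ }
    single : Fraction 1000 (single-weight (deg u)) (Single v)
    single with deg u ℕ.≟ 2 | 2≤deg u∈A | deg≤3 u∈A
    ... | yes e | _ | _ = subst (λ d → Fraction 1000 (single-weight d) (Single v)) (≡-sym e)
      (enlarge (ℕ.*-monoˡ-≤ 200 (ℕ.≤-pred (subst (1 + length (far-nbrs v u) ≤_) e 1+far≤))) single-via-u)
    ... | no ≢2 | 2≤ | ≤3 = subst (λ d → Fraction 1000 (single-weight d) (Single v)) (ℕ.≤-antisym (ℕ.≤∧≢⇒< 2≤ (≢2 ∘ ≡-sym)) ≤3)
      (single-fraction v∈A (≤-reflexive (cong suc (≡-sym ≡2))) (cw-weight 3))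
    both : Fraction 1000 (cw (2 + deg u)) (λ S → Single u S × Single w S)
    both = weaken (λ _ (s , t) → ++-closed (single-closed s) (single-closed t))
      (closed-fraction u∈A (here refl) (w ∷ []) ([] ∷ []) ((w∈A , there (here (inj₁ refl)) , u≢w ∘ ≡-sym , not-triangle) ∷ [])
        (s≤s (≤-reflexive (ℕ.+-comm 1 (deg u)))) (cw-weight (2 + deg u)))
    small : ∀ p q → 2 ≤ p → p ≤ 3 → q ≤ 3 →
            single-weight p + (p * cw (2 + p) + (q * cw (2 + q) + cw (2 + p))) ≤ 1000
    small 2 0 _ _ _ = ≤!
    small 2 1 _ _ _ = ≤!
    small 2 2 _ _ _ = ≤!
    small 2 3 _ _ _ = ≤!
    small 3 0 _ _ _ = ≤!
    small 3 1 _ _ _ = ≤!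
    small 3 2 _ _ _ = ≤!
    small 3 3 _ _ _ = ≤!
    small 1 _ (s≤s ()) _ _
    small (suc (suc (suc (suc _)))) _ _ (s≤s (s≤s (s≤s ()))) _
    small _ (suc (suc (suc (suc _)))) _ _ (s≤s (s≤s (s≤s ())))
    cover : ∀ {S} → Maximal A S →
            Single v S ⊎ PairedWith (nbrs u) u S ⊎ PairedWith (nbrs w) w S ⊎ (Single u S × Single w S)
    cover m with around v∈A m
    ... | inj₁ s = inj₁ s
    ... | inj₂ (inj₁ (x , x∈ , y , y∈ , p)) with nbr-cases x∈
    ...   | inj₁ refl = inj₂ (inj₁ (y , y∈ , p))
    ...   | inj₂ refl = inj₂ (inj₂ (inj₁ (y , y∈ , p)))
    cover m | inj₂ (inj₂ (x , y , x≢y , x∈ , y∈ , s , t)) with nbr-cases x∈ | nbr-cases y∈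
    ... | inj₁ refl | inj₁ refl = contradiction refl x≢y
    ... | inj₂ refl | inj₂ refl = contradiction refl x≢y
    ... | inj₁ refl | inj₂ refl = inj₂ (inj₂ (inj₂ (s , t)))
    ... | inj₂ refl | inj₁ refl = inj₂ (inj₂ (inj₂ (t , s)))

  abstract

    deg≡3 : ∀ {v} → v ∈ A → deg v ≡ 3
    deg≡3 v∈A = ℕ.≤-antisym (deg≤3 v∈A) (ℕ.≤∧≢⇒< (2≤deg v∈A) (deg≢2 v∈A ∘ ≡-sym))

  -- Cubic graphs

  exactly-three : ∀ {v a b c} → v ∈ A → a ∈ₗ nbrs v → b ∈ₗ nbrs v → c ∈ₗ nbrs v → a ≢ b → a ≢ c → b ≢ c →
                  ∀ {x} → x ∈ₗ nbrs v → x ∈ₗ a ∷ b ∷ c ∷ []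
  exactly-three {v} {a} {b} {c} v∈A a∈ b∈ c∈ a≢b a≢c b≢c {x} x∈ with Any.any? (x Fin.≟_) (a ∷ b ∷ c ∷ [])
  ... | yes x∈abc = x∈abc
  ... | no x∉abc = contradiction (≤-trans four≤ (≤-reflexive (deg≡3 v∈A))) λ { (s≤s (s≤s (s≤s ()))) }
    where
    four≤ : 4 ≤ deg v
    four≤ = unique-⊆⇒length≤ {xs = x ∷ a ∷ b ∷ c ∷ []}
      (All.¬Any⇒All¬ _ x∉abc ∷ (a≢b ∷ a≢c ∷ []) ∷ (b≢c ∷ []) ∷ [] ∷ [])
      λ { (here refl) → x∈ ; (there (here refl)) → a∈ ; (there (there (here refl))) → b∈ ; (there (there (there (here refl)))) → c∈ }

  3≤+far : ∀ {v a} ks → a ∈ A → (∀ {x} → x ∈ₗ nbrs a → x ∉ₗ ks → Far v x) → 3 ≤ length ks + length (far-nbrs v a)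
  3≤+far {v} {a} ks a∈A far = subst (_≤ length ks + length (far-nbrs v a)) (deg≡3 a∈A)
    (≤-trans (unique-⊆⇒length≤ (nbrs! a) λ {x} x∈ → case Any.any? (x Fin.≟_) ks of λ
      { (yes x∈ks) → ∈-++⁺ˡ x∈ks ; (no x∉ks) → ∈-++⁺ʳ ks (∈-filter⁺ (far? v) x∈ (far x∈ x∉ks)) })
      (≤-reflexive (length-++ ks)))

  4+far : ∀ {v a} → v ∈ A → ∀ j → j ≤ length (far-nbrs v a) → 4 + j ≤ suc (deg v + length (far-nbrs v a))
  4+far {v} {a} v∈A j j≤ = s≤s (≤-trans (ℕ.+-monoʳ-≤ 3 j≤) (≤-reflexive (cong (_+ length (far-nbrs v a)) (≡-sym (deg≡3 v∈A)))))

  -- As all degrees are 3, these are all the neighbours of `v`. Edges among them are allowed, so the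
  -- claw need not be induced.
  record Claw (v a b c : Fin N) : Set where
    field
      v∈A : v ∈ A
      a∈  : a ∈ₗ nbrs v
      b∈  : b ∈ₗ nbrs v
      c∈  : c ∈ₗ nbrs v
      a≢b : a ≢ b
      a≢c : a ≢ c
      b≢c : b ≢ c

    a∈A : a ∈ A
    a∈A = proj₁ (∈-nbrs⁻ a∈)
    b∈A : b ∈ A
    b∈A = proj₁ (∈-nbrs⁻ b∈)
    c∈A : c ∈ A
    c∈A = proj₁ (∈-nbrs⁻ c∈)
    v~a : v ~ a
    v~a = proj₂ (∈-nbrs⁻ a∈)
    v~b : v ~ b
    v~b = proj₂ (∈-nbrs⁻ b∈)
    v~c : v ~ c
    v~c = proj₂ (∈-nbrs⁻ c∈)

    nbr-cases : ∀ {x} → x ∈ₗ nbrs v → x ≡ a ⊎ x ≡ b ⊎ x ≡ c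
    nbr-cases x∈ with exactly-three v∈A a∈ b∈ c∈ a≢b a≢c b≢c x∈
    ... | here p = inj₁ p
    ... | there (here p) = inj₂ (inj₁ p)
    ... | there (there (here p)) = inj₂ (inj₂ p)

    far-from-v : ∀ {x} → x ∈ₗ nbrs a → x ≢ v → (x ≡ b → ¬ (a ~ b)) → (x ≡ c → ¬ (a ~ c)) → Far v x
    far-from-v x∈ x≢v ¬b ¬c = x≢v , λ v~x → case nbr-cases (∈-nbrs⁺ (proj₁ (∈-nbrs⁻ x∈)) v~x) of λ
      { (inj₁ refl) → ~-irrefl (proj₂ (∈-nbrs⁻ x∈))
      ; (inj₂ (inj₁ refl)) → ¬b refl (proj₂ (∈-nbrs⁻ x∈))
      ; (inj₂ (inj₂ refl)) → ¬c refl (proj₂ (∈-nbrs⁻ x∈)) }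

    2≤far : ¬ (a ~ b) → ¬ (a ~ c) → 2 ≤ length (far-nbrs v a)
    2≤far a≁b a≁c = ℕ.≤-pred (3≤+far (v ∷ []) a∈A λ x∈ x∉ → far-from-v x∈ (x∉ ∘ here) (λ _ → a≁b) (λ _ → a≁c))

    1≤far : ¬ (a ~ c) → 1 ≤ length (far-nbrs v a)
    1≤far a≁c = ℕ.≤-pred (ℕ.≤-pred (3≤+far (v ∷ b ∷ []) a∈A λ x∈ x∉ →
      far-from-v x∈ (x∉ ∘ here) (λ x≡b → contradiction (there (here x≡b)) x∉) (λ _ → a≁c)))

    inner : a ~ b → a ~ c → Inner v a
    inner a~b a~c with far-nbrs v a in eq
    ... | [] = refl
    ... | x ∷ _ with ∈-far-nbrs⁻ {v} {a} (subst (x ∈ₗ_) (≡-sym eq) (here refl))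
    ...   | x∈A , a~x , x≢v , v≁x with exactly-three a∈A (∈-nbrs⁺ v∈A (~-sym v~a)) (∈-nbrs⁺ b∈A a~b) (∈-nbrs⁺ c∈A a~c)
                                        (~⇒≢ v~b) (~⇒≢ v~c) b≢c (∈-nbrs⁺ x∈A a~x)
    ...     | here x≡v = contradiction x≡v x≢v
    ...     | there (here refl) = contradiction v~b v≁x
    ...     | there (there (here refl)) = contradiction v~c v≁x

    pairs : ∀ {M W₁ W₂ W₃} → Fraction M W₁ (Pair v a) → Fraction M W₂ (Pair v b) → Fraction M W₃ (Pair v c) →
            Fraction M (W₁ + (W₂ + W₃)) (PairedWith (nbrs v) v)
    pairs f g h = weaken (λ _ (x , x∈ , p) → case nbr-cases x∈ of λ
      { (inj₁ refl) → inj₁ p ; (inj₂ (inj₁ refl)) → inj₂ (inj₁ p) ; (inj₂ (inj₂ refl)) → inj₂ (inj₂ p) }) (f ∪ᶠ g ∪ᶠ h)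

  open Claw using (2≤far; 1≤far; inner)

  claw-swap : ∀ {v a b c} → Claw v a b c → Claw v b a c
  claw-swap k = record { v∈A = v∈A ; a∈ = b∈ ; b∈ = a∈ ; c∈ = c∈ ; a≢b = a≢b ∘ ≡-sym ; a≢c = b≢c ; b≢c = a≢c }
    where open Claw k

  claw-rotate : ∀ {v a b c} → Claw v a b c → Claw v b c a
  claw-rotate k = record { v∈A = v∈A ; a∈ = b∈ ; b∈ = c∈ ; c∈ = a∈ ; a≢b = b≢c ; a≢c = a≢b ∘ ≡-sym ; b≢c = a≢c ∘ ≡-sym }
    where open Claw k

  -- Each neighbour of `v` has two neighbours outside N[v], so each pair deletes 6 vertices: 631 +
  -- 159 + 3 * 64 = 982.
  no-edge : ∀ {v a b c} → Claw v a b c → ¬ (a ~ b) → ¬ (a ~ c) → ¬ ¬ (b ~ c)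
  no-edge k a≁b a≁c b≁c = star v∈A (cw-weight 1)
    (single-fraction v∈A (≤-reflexive (cong suc (≡-sym (deg≡3 v∈A)))) (cw-weight 4))
    (pairs (pair-fraction v∈A (4+far v∈A 2 (2≤far k a≁b a≁c)) (cw-weight 6))
           (pair-fraction v∈A (4+far v∈A 2 (2≤far (claw-rotate k) b≁c (a≁b ∘ ~-sym))) (cw-weight 6))
           (pair-fraction v∈A (4+far v∈A 2 (2≤far (claw-rotate (claw-rotate k)) (a≁c ∘ ~-sym) (b≁c ∘ ~-sym))) (cw-weight 6)))
    ≤!
    where open Claw k hiding (2≤far)

  -- `a` is inner, which excludes an isolated `v`, while `b` and `c` each have a neighbour outside
  -- N[v]. The total is 631 + 159 + 2 * 100 = 990.
  two-edges : ∀ {v a b c} → Claw v a b c → a ~ b → a ~ c → ¬ ¬ (b ~ c)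
  two-edges k a~b a~c b≁c = star v∈A (cw-weight 1) (no-single a∈ (inner k a~b a~c))
    (pairs (pair-fraction v∈A (4+far v∈A 0 z≤n) (cw-weight 4))
           (pair-fraction v∈A (4+far v∈A 1 (1≤far (claw-swap k) b≁c)) (cw-weight 5))
           (pair-fraction v∈A (4+far v∈A 1 (1≤far (claw-rotate (claw-rotate k)) (b≁c ∘ ~-sym))) (cw-weight 5)))
    ≤!
    where open Claw k hiding (1≤far; inner)

  -- N[v] is then a component K₄. As 4^5 = 1024 > 10^3, at most 3 traces on N(v) occur, and (3 + 3)
  -- * 159 = 954.
  three-edges : ∀ {v a b c} → Claw v a b c → a ~ b → a ~ c → ¬ (b ~ c)
  three-edges {v} k a~b a~c b~c = not-all-inner 3 v∈A (subst (0 <_) (≡-sym (deg≡3 v∈A)) ≤!)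
    (λ l l^5≤ → ℕ.≮⇒≥ λ 4≤l → ℕ.<⇒≱ (≤! {1001} {4 ^ 5}) (≤-trans (ℕ.^-monoˡ-≤ 5 4≤l) (subst (λ d → l ^ 5 ≤ 10 ^ d) (deg≡3 v∈A) l^5≤)))
    (subst (λ d → (d + 3) * cw (suc d) ≤ 1000) (≡-sym (deg≡3 v∈A)) ≤!)
    (All.tabulate λ x∈ → case nbr-cases x∈ of λ
      { (inj₁ refl) → inner k a~b a~c
      ; (inj₂ (inj₁ refl)) → inner (claw-rotate k) b~c (~-sym a~b)
      ; (inj₂ (inj₂ refl)) → inner (claw-rotate (claw-rotate k)) (~-sym a~c) (~-sym b~c) })
    where open Claw k hiding (inner)

  -- Exactly one edge inside N(v)

  module OneEdge {v a b c} (k : Claw v a b c) (a~b : a ~ b) (a≁c : ¬ (a ~ c)) (b≁c : ¬ (b ~ c)) where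
    open Claw k hiding (2≤far; 1≤far; inner)

    -- Otherwise `b` is adjacent to the two other neighbours `v` and `y` of `a`, which are not
    -- adjacent to each other: the case of two edges, centred at `a`.
    no-second-triangle : ∀ {y} → y ∈ A → a ~ y → b ~ y → y ≢ v → Falsum
    no-second-triangle {y} y∈A a~y b~y y≢v = two-edges
      (record { v∈A = a∈A ; a∈ = ∈-nbrs⁺ b∈A a~b ; b∈ = ∈-nbrs⁺ v∈A (~-sym v~a) ; c∈ = ∈-nbrs⁺ y∈A a~y
              ; a≢b = ~⇒≢ (~-sym v~b) ; a≢c = ~⇒≢ b~y ; b≢c = y≢v ∘ ≡-sym })
      (~-sym v~b) b~y λ v~y → case nbr-cases (∈-nbrs⁺ y∈A v~y) of λ
        { (inj₁ refl) → ~-irrefl a~y ; (inj₂ (inj₁ refl)) → ~-irrefl b~y ; (inj₂ (inj₂ refl)) → a≁c a~y }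

    pair-v-a : Fraction 1000 100 (Pair v a)
    pair-v-a = pair-fraction v∈A (4+far v∈A 1 (1≤far k a≁c)) (cw-weight 5)

    -- Besides `v` and `b`, `a` has just one neighbour `y`. It shares no neighbour with `a`: `v` is
    -- not adjacent to it, and `b` is excluded by `no-second-triangle`. So the pair deletes 6
    -- vertices.
    pairs-a : Fraction 1000 64 (PairedWith (far-nbrs v a) a)
    pairs-a = enlarge (ℕ.*-monoˡ-≤ 64 ∣far∣≤1) (⋃ᶠ (far-nbrs v a) λ y∈ →
      pair-fraction a∈A (4+far a∈A 2 (2≤ y∈)) (cw-weight 6))
      where
      ∣far∣≤1 : length (far-nbrs v a) ≤ 1
      ∣far∣≤1 = ℕ.≤-pred (ℕ.≤-pred (≤-trans (unique-⊆⇒length≤ {xs = v ∷ b ∷ far-nbrs v a}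
        ((~⇒≢ v~b ∷ All.tabulate λ x∈ → proj₁ (∈-far-nbrs⇒Far x∈) ∘ ≡-sym)
         ∷ All.tabulate (λ { x∈ refl → proj₂ (∈-far-nbrs⇒Far x∈) v~b })
         ∷ far-nbrs! v a)
        λ { (here refl) → ∈-nbrs⁺ v∈A (~-sym v~a)
          ; (there (here refl)) → ∈-nbrs⁺ b∈A a~b
          ; (there (there x∈)) → far-nbrs⊆nbrs x∈ })
        (≤-reflexive (deg≡3 a∈A))))
      2≤ : ∀ {y} → y ∈ₗ far-nbrs v a → 2 ≤ length (far-nbrs a y)
      2≤ {y} y∈ with ∈-far-nbrs⁻ y∈
      ... | y∈A , a~y , y≢v , v≁y = ℕ.≤-pred (3≤+far (a ∷ []) y∈A λ {x} x∈ x∉ → x∉ ∘ here , λ a~x →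
        case exactly-three a∈A (∈-nbrs⁺ v∈A (~-sym v~a)) (∈-nbrs⁺ b∈A a~b) (∈-nbrs⁺ y∈A a~y)
               (~⇒≢ v~b) (y≢v ∘ ≡-sym) (λ { refl → v≁y v~b }) (∈-nbrs⁺ (proj₁ (∈-nbrs⁻ x∈)) a~x) of λ
          { (here refl) → v≁y (~-sym (proj₂ (∈-nbrs⁻ x∈)))
          ; (there (here refl)) → no-second-triangle y∈A a~y (~-sym (proj₂ (∈-nbrs⁻ x∈))) y≢v
          ; (there (there (here refl))) → ~-irrefl (proj₂ (∈-nbrs⁻ x∈)) })

    pair-a-b : Fraction 1000 100 (Pair a b)
    pair-a-b = pair-fraction a∈A (4+far a∈A 1 (ℕ.≤-pred (ℕ.≤-pred (3≤+far (a ∷ v ∷ []) b∈A λ x∈ x∉ →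
      x∉ ∘ here , λ a~x → let (x∈A , b~x) = ∈-nbrs⁻ x∈ in no-second-triangle x∈A a~x b~x (λ x≡v → x∉ (there (here x≡v))))))) (cw-weight 5)

    -- Deleted are the 4 vertices of N[c] and, outside it, `a` with its neighbour `b`.
    singles-c-a : Fraction 1000 64 (λ S → Single c S × Single a S)
    singles-c-a = weaken (λ _ (s , t) → ++-closed (single-closed s) (single-closed t))
      (closed-fraction c∈A (here refl) (a ∷ b ∷ []) ((a≢b ∷ []) ∷ [] ∷ [])
        ((a∈A , there (here (inj₁ refl)) , a≢c , a≁c ∘ ~-sym) ∷ (b∈A , there (here (inj₂ a~b)) , b≢c , b≁c ∘ ~-sym) ∷ [])
        (s≤s (≤-reflexive (cong (_+ 2) (≡-sym (deg≡3 c∈A))))) (cw-weight 6))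

    pair-v-c : Fraction 1000 64 (Pair v c)
    pair-v-c = pair-fraction v∈A (4+far v∈A 2 (2≤far (claw-rotate (claw-rotate k)) (a≁c ∘ ~-sym) (b≁c ∘ ~-sym))) (cw-weight 6)

    pairs-c : Fraction 1000 200 (PairedWith (far-nbrs v c) c)
    pairs-c = enlarge (ℕ.*-monoˡ-≤ 100 ∣far∣≤2) (⋃ᶠ (far-nbrs v c) λ y∈ →
      pair-fraction c∈A (4+far c∈A 1 (1≤ y∈)) (cw-weight 5))
      where
      v∈nbrs-c : v ∈ₗ nbrs c
      v∈nbrs-c = ∈-nbrs⁺ v∈A (~-sym v~c)
      ∣far∣≤2 : length (far-nbrs v c) ≤ 2
      ∣far∣≤2 = ℕ.≤-pred (≤-trans (unique-⊆⇒length≤ {xs = v ∷ far-nbrs v c}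
        (All.tabulate (λ x∈ → proj₁ (∈-far-nbrs⇒Far x∈) ∘ ≡-sym) ∷ far-nbrs! v c)
        λ { (here refl) → v∈nbrs-c ; (there x∈) → far-nbrs⊆nbrs x∈ })
        (≤-reflexive (deg≡3 c∈A)))
      -- Besides `c`, only the neighbour of `c` other than `v` and `y` can lie in both N(y) and
      -- N[c], so one of the three neighbours of `y` is outside N[c].
      1≤ : ∀ {y} → y ∈ₗ far-nbrs v c → 1 ≤ length (far-nbrs c y)
      1≤ {y} y∈ with ∈-far-nbrs⁻ y∈
      ... | y∈A , c~y , y≢v , v≁y = ℕ.+-cancelˡ-≤ 2 1 _
        (≤-trans (3≤+far (c ∷ rest) y∈A far) (ℕ.+-monoˡ-≤ _ (s≤s ∣rest∣≤1)))
        where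
        rest = filter (_≢? y) (v ∉-nbrs c)
        ∣rest∣≤1 : length rest ≤ 1
        ∣rest∣≤1 = ℕ.≤-pred (≤-trans
          (filter-notAll (_≢? y) (v ∉-nbrs c) (Any.map (λ { refl ≢ → ≢ refl }) (∈-filter⁺ (_≢? v) (∈-nbrs⁺ y∈A c~y) y≢v)))
          (ℕ.≤-pred (≤-trans (∣∉-nbrs∣ v∈nbrs-c) (≤-reflexive (deg≡3 c∈A)))))
        far : ∀ {x} → x ∈ₗ nbrs y → x ∉ₗ c ∷ rest → Far c x
        far x∈ x∉ with ∈-nbrs⁻ x∈
        ... | x∈A , y~x = x∉ ∘ here , λ c~x → x∉ (there (∈-filter⁺ (_≢? y)
          (∈-filter⁺ (_≢? v) (∈-nbrs⁺ x∈A c~x) λ { refl → v≁y (~-sym y~x) }) λ { refl → ~-irrefl y~x }))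

  -- The split at `v` would weigh 631 + 159 + 100 + 100 + 64 = 1054. The cover by edges meeting N(v)
  -- and pairs of isolated vertices, with the edge between `a` and `b` counted once, weighs 979.
  one-edge : ∀ {v a b c} → Claw v a b c → a ~ b → ¬ (a ~ c) → ¬ ¬ (b ~ c)
  one-edge {v} {a} {b} {c} k a~b a≁c b≁c = conclude
    (single-fraction v∈A (≤-reflexive (cong suc (≡-sym (deg≡3 v∈A)))) (cw-weight 4)
     ∪ᶠ (I.pair-v-a ∪ᶠ I.pair-a-b ∪ᶠ I.pairs-a)
     ∪ᶠ (J.pair-v-a ∪ᶠ J.pairs-a)
     ∪ᶠ (I.pair-v-c ∪ᶠ I.pairs-c)
     ∪ᶠ I.singles-c-a ∪ᶠ J.singles-c-a)
    ≤! cover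
    where
    open Claw k hiding (inner; 2≤far; 1≤far)
    module I = OneEdge k a~b a≁c b≁c
    module J = OneEdge (claw-swap k) (~-sym a~b) b≁c a≁c
    near-v : ∀ {x y} → y ∈ₗ nbrs x → y ∈ₗ far-nbrs v x ⊎ y ≡ v ⊎ v ~ y
    near-v {x} {y} y∈ with y Fin.≟ v | v ~? y
    ... | yes y≡v | _ = inj₂ (inj₁ y≡v)
    ... | no _ | yes v~y = inj₂ (inj₂ v~y)
    ... | no y≢v | no v≁y = inj₁ (∈-filter⁺ (far? v) y∈ (y≢v , v≁y))
    cover : ∀ {S} → Maximal A S → Single v S
      ⊎ (Pair v a S ⊎ Pair a b S ⊎ PairedWith (far-nbrs v a) a S)
      ⊎ (Pair v b S ⊎ PairedWith (far-nbrs v b) b S)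
      ⊎ (Pair v c S ⊎ PairedWith (far-nbrs v c) c S)
      ⊎ (Single c S × Single a S) ⊎ (Single c S × Single b S)
    cover m with around v∈A m
    ... | inj₁ s = inj₁ s
    ... | inj₂ (inj₁ (x , x∈ , y , y∈ , p@(_ , _ , x~y))) with nbr-cases x∈ | near-v y∈
    ...   | inj₁ refl | inj₁ far = inj₂ (inj₁ (inj₂ (inj₂ (y , far , p))))
    ...   | inj₁ refl | inj₂ (inj₁ refl) = inj₂ (inj₁ (inj₁ (Pair-sym p)))
    ...   | inj₂ (inj₁ refl) | inj₁ far = inj₂ (inj₂ (inj₁ (inj₂ (y , far , p))))
    ...   | inj₂ (inj₁ refl) | inj₂ (inj₁ refl) = inj₂ (inj₂ (inj₁ (inj₁ (Pair-sym p))))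
    ...   | inj₂ (inj₂ refl) | inj₁ far = inj₂ (inj₂ (inj₂ (inj₁ (inj₂ (y , far , p)))))
    ...   | inj₂ (inj₂ refl) | inj₂ (inj₁ refl) = inj₂ (inj₂ (inj₂ (inj₁ (inj₁ (Pair-sym p)))))
    ...   | x≡ | inj₂ (inj₂ v~y) with x≡ | nbr-cases (∈-nbrs⁺ (proj₁ (∈-nbrs⁻ y∈)) v~y)
    ...     | inj₁ refl | inj₁ refl = contradiction x~y ~-irrefl
    ...     | inj₁ refl | inj₂ (inj₁ refl) = inj₂ (inj₁ (inj₂ (inj₁ p)))
    ...     | inj₁ refl | inj₂ (inj₂ refl) = contradiction x~y a≁c
    ...     | inj₂ (inj₁ refl) | inj₁ refl = inj₂ (inj₁ (inj₂ (inj₁ (Pair-sym p))))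
    ...     | inj₂ (inj₁ refl) | inj₂ (inj₁ refl) = contradiction x~y ~-irrefl
    ...     | inj₂ (inj₁ refl) | inj₂ (inj₂ refl) = contradiction x~y b≁c
    ...     | inj₂ (inj₂ refl) | inj₁ refl = contradiction (~-sym x~y) a≁c
    ...     | inj₂ (inj₂ refl) | inj₂ (inj₁ refl) = contradiction (~-sym x~y) b≁c
    ...     | inj₂ (inj₂ refl) | inj₂ (inj₂ refl) = contradiction x~y ~-irrefl
    cover m | inj₂ (inj₂ (x , y , x≢y , x∈ , y∈ , s , t)) with nbr-cases x∈ | nbr-cases y∈
    ... | inj₁ refl | inj₁ refl = contradiction refl x≢y
    ... | inj₁ refl | inj₂ (inj₁ refl) = contradiction a~b (proj₂ s (proj₁ t))
    ... | inj₁ refl | inj₂ (inj₂ refl) = inj₂ (inj₂ (inj₂ (inj₂ (inj₁ (t , s)))))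
    ... | inj₂ (inj₁ refl) | inj₁ refl = contradiction a~b (proj₂ t (proj₁ s))
    ... | inj₂ (inj₁ refl) | inj₂ (inj₁ refl) = contradiction refl x≢y
    ... | inj₂ (inj₁ refl) | inj₂ (inj₂ refl) = inj₂ (inj₂ (inj₂ (inj₂ (inj₂ (t , s)))))
    ... | inj₂ (inj₂ refl) | inj₁ refl = inj₂ (inj₂ (inj₂ (inj₂ (inj₁ (s , t)))))
    ... | inj₂ (inj₂ refl) | inj₂ (inj₁ refl) = inj₂ (inj₂ (inj₂ (inj₂ (inj₂ (s , t)))))
    ... | inj₂ (inj₂ refl) | inj₂ (inj₂ refl) = contradiction refl x≢y

  no-claw : ∀ {v a b c} → ¬ Claw v a b c
  no-claw {v} {a} {b} {c} k with a ~? b | a ~? c | b ~? c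
  ... | yes a~b | yes a~c | yes b~c = three-edges k a~b a~c b~c
  ... | yes a~b | yes a~c | no b≁c = two-edges k a~b a~c b≁c
  ... | yes a~b | no a≁c | yes b~c = two-edges (claw-rotate k) b~c (~-sym a~b) (a≁c ∘ ~-sym)
  ... | yes a~b | no a≁c | no b≁c = one-edge k a~b a≁c b≁c
  ... | no a≁b | yes a~c | yes b~c = two-edges (claw-rotate (claw-rotate k)) (~-sym a~c) (~-sym b~c) a≁b
  ... | no a≁b | yes a~c | no b≁c = one-edge (claw-rotate (claw-rotate k)) (~-sym a~c) (b≁c ∘ ~-sym) a≁b
  ... | no a≁b | no a≁c | yes b~c = one-edge (claw-rotate k) b~c (a≁b ∘ ~-sym) (a≁c ∘ ~-sym)
  ... | no a≁b | no a≁c | no b≁c = no-edge k a≁b a≁c b≁c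

  A-empty : ∀ {v} → v ∉ A
  A-empty {v} v∈A with length≡3 (nbrs v) (deg≡3 v∈A)
  ... | a , b , c , eq with subst Unique eq (nbrs! v)
  ...   | (a≢b ∷ a≢c ∷ []) ∷ (b≢c ∷ []) ∷ _ = no-claw (record
    { v∈A = v∈A ; a∈ = back (here refl) ; b∈ = back (there (here refl)) ; c∈ = back (there (there (here refl)))
    ; a≢b = a≢b ; a≢c = a≢c ; b≢c = b≢c })
    where
    back : ∀ {x} → x ∈ₗ a ∷ b ∷ c ∷ [] → x ∈ₗ nbrs v
    back = subst (_ ∈ₗ_) (≡-sym eq)

  -- Once `A` is empty, only the empty set remains, so `L` has at most one entry, against `large`.
  absurd : Falsum
  absurd = ℕ.<⇒≱ large (≤-trans (ℕ.^-monoˡ-≤ 5 (all-equal⇒length≤1 L! λ S∈L T∈L →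
    ⊆-antisym (λ x∈ → contradiction (⊆-ambient (∈L⇒maximal S∈L) x∈) A-empty)
              (λ x∈ → contradiction (⊆-ambient (∈L⇒maximal T∈L) x∈) A-empty))) (ℕ.m^n>0 10 ∣ A ∣))

-- Strong induction on the size of the ambient set

maximal-bound : ∀ {N} (G : Graph N) n {A : Subset N} → ∣ A ∣ < n → ∀ {L} → Unique L →
                All (Dissociation.Maximal G A) L → length L ^ 5 ≤ 10 ^ ∣ A ∣
-- `n` is a strict upper bound for the size of `A` that drops by one at each call, which makes the
-- strong induction structural.
maximal-bound G (suc n) {A} (s≤s ∣A∣≤n) {L} L! L-maximal with length L ^ 5 ≤? 10 ^ ∣ A ∣
... | yes bounded = bounded
... | no large = ⊥-elim (Branching.absurd G A
  (λ ∣A′∣<∣A∣ → maximal-bound G n (≤-trans ∣A′∣<∣A∣ ∣A∣≤n)) L! L-maximal (ℕ.≰⇒> large))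

theorem7 : (N : ℕ) (G : Graph N) (L : List (Subset N)) → Unique L → All (MaximalDegAtMost 1 G) L → length L ^ 5 ≤ 10 ^ N
theorem7 N G L L! L-maximal = subst (λ k → length L ^ 5 ≤ 10 ^ k) (∣⊤∣≡n N)
  (maximal-bound G (suc ∣ ⊤ {N} ∣) ≤-refl L! (All.map (Dissociation.maximalDeg⇒maximal G) L-maximal))
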